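{- For every $\alpha\in(0,1/5)$ there is a constant $c=c(\alpha)>0$ such that for every positive integer $d$ and every sufficiently large $n$ there exists a bipartite graph $G$ with $n$ vertices on each side and average degree $d$ that is a $(k,\alpha)$-multitasker for all positive integers $k\le c\,n/d^{1+4\alpha}$.
   Context: Graphs are finite and simple. A matching is a set of edges no two of which share a vertex. A matching $M'$ in $G$ is induced if no two distinct edges of $M'$ are joined by an edge of $G$. A bipartite graph $G=(A\cup B,E)$ with $|A|=|B|=n$ is a $(k,\alpha)$-multitasker if for every matching $M$ in $G$ of size $|M|=k$ there is a matching $M'\subseteq M$ that is induced in $G$ with $|M'|\ge\alpha|M|$. "Sufficiently large $n$" may depend on $d$ and $\alpha$. -}

module Defs where

open import Algebra.Definitions.RawSemiring using () renaming (_^_ to pow)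
open import Data.Bool.Base using (Bool; T; if_then_else_)
open import Data.Empty using (⊥)
open import Data.Fin.Base using (Fin)
open import Data.Integer.Base using (ℤ; +_; -[1+_])
open import Data.Nat.Base as ℕ using (ℕ; zero; suc; NonZero)
open import Data.Nat.Properties using (m^n≢0; +-0-commutativeMonoid)
open import Algebra.Properties.CommutativeMonoid.Sum +-0-commutativeMonoid using (sum)
open import Data.Product.Base using (Σ-syntax; ∃-syntax; _×_; _,_)
open import Data.Rational.Base as ℚ using (ℚ; 0ℚ; 1ℚ; ↥_; ↧ₙ_; _/_)
open import Data.Sum.Base using (_⊎_)
open import Relation.Binary.PropositionalEquality using (_≡_)
open import Relation.Nullary using (¬_)

-- Real numbers are two-sided Dedekind cuts.  The operations are given by the
-- usual formulas on bare pairs of sets of rationals; the axioms of a Dedekind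
-- cut are the separate predicate IsReal, over which real variables range.

record Cut : Set₁ where
  field
    L : ℚ → Set   -- rationals below
    U : ℚ → Set   -- rationals above

open Cut public

record IsReal (x : Cut) : Set where
  field
    L-inhabited : ∃[ q ] L x q
    U-inhabited : ∃[ q ] U x q
    L-closed    : ∀ {p q} → p ℚ.< q → L x q → L x p
    U-closed    : ∀ {p q} → p ℚ.< q → U x p → U x q
    L-open      : ∀ {p} → L x p → ∃[ q ] (p ℚ.< q × L x q)
    U-open      : ∀ {q} → U x q → ∃[ p ] (p ℚ.< q × U x p)
    disjoint    : ∀ {q} → L x q → U x q → ⊥
    located     : ∀ {p q} → p ℚ.< q → L x p ⊎ U x q

infix 4 _<ʳ_ _≤ʳ_

_<ʳ_ : Cut → Cut → Set
x <ʳ y = ∃[ q ] (U x q × L y q)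

_≤ʳ_ : Cut → Cut → Set
x ≤ʳ y = ∀ q → L x q → L y q

fromℚ : ℚ → Cut
fromℚ r = record { L = λ q → q ℚ.< r ; U = λ q → r ℚ.< q }

fromℕ : ℕ → Cut
fromℕ m = fromℚ (+ m / 1)

infixl 6 _+ʳ_
infixr 7 _·_
infixr 8 _^ʳ_

_+ʳ_ : Cut → Cut → Cut
x +ʳ y = record
  { L = λ s → ∃[ p ] ∃[ q ] (L x p × L y q × s ≡ p ℚ.+ q)
  ; U = λ s → ∃[ p ] ∃[ q ] (U x p × U y q × s ≡ p ℚ.+ q)
  }

_·_ : ℕ → Cut → Cut
zero  · x = fromℚ 0ℚ
suc m · x = x +ʳ m · x

_^ℚ_ : ℚ → ℕ → ℚ
_^ℚ_ = pow ℚ.+-*-rawSemiring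

_^ℤ_ : (d : ℕ) .{{_ : NonZero d}} → ℤ → ℚ
d ^ℤ (+ m)      = + (d ℕ.^ m) / 1
d ^ℤ (-[1+ m ]) = _/_ (+ 1) (d ℕ.^ suc m) {{m^n≢0 d (suc m)}}

-- For an integer d ≥ 1 and real x,
--   d ^ x = sup { d ^ t : t rational, t < x } = inf { d ^ t : t rational, t > x },
-- where for t = a / b and y ≥ 0 the comparison y ≤ d ^ t means y ^ b ≤ d ^ a,
-- and likewise for ≥.

_^ʳ_ : (d : ℕ) .{{_ : NonZero d}} → Cut → Cut
d ^ʳ x = record
  { L = λ q → ∃[ t ] ∃[ y ] (L x t × q ℚ.< y × 0ℚ ℚ.≤ y × (y ^ℚ (↧ₙ t)) ℚ.≤ (d ^ℤ (↥ t)))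
  ; U = λ q → ∃[ t ] ∃[ y ] (U x t × y ℚ.< q × 0ℚ ℚ.≤ y × (d ^ℤ (↥ t)) ℚ.≤ (y ^ℚ (↧ₙ t)))
  }

-- The two sides A and B are two copies of Fin n; an edge is a pair in A × B.

Edge : ℕ → Set
Edge n = Fin n × Fin n

EdgeSet : ℕ → Set
EdgeSet n = Edge n → Bool

BipartiteGraph : ℕ → Set
BipartiteGraph = EdgeSet

infix 4 _∈_ _⊆_

_∈_ : ∀ {n} → Edge n → EdgeSet n → Set
e ∈ F = T (F e)

_⊆_ : ∀ {n} → EdgeSet n → EdgeSet n → Set
F ⊆ H = ∀ e → e ∈ F → e ∈ H

indicator : Bool → ℕ
indicator b = if b then 1 else 0

∣_∣ : ∀ {n} → EdgeSet n → ℕ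
∣ F ∣ = sum λ a → sum λ b → indicator (F (a , b))

degreeA : ∀ {n} → BipartiteGraph n → Fin n → ℕ
degreeA G a = sum λ b → indicator (G (a , b))

degreeB : ∀ {n} → BipartiteGraph n → Fin n → ℕ
degreeB G b = sum λ a → indicator (G (a , b))

-- The sum of all degrees is d times the number n + n of vertices.
HasAverageDegree : ∀ {n} → BipartiteGraph n → ℕ → Set
HasAverageDegree {n} G d = sum (degreeA G) ℕ.+ sum (degreeB G) ≡ d ℕ.* (n ℕ.+ n)

ShareVertex : ∀ {n} → Edge n → Edge n → Set
ShareVertex (a , b) (a′ , b′) = a ≡ a′ ⊎ b ≡ b′

IsMatching : ∀ {n} → EdgeSet n → Set
IsMatching F = ∀ e f → e ∈ F → f ∈ F → ShareVertex e f → e ≡ f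

MatchingIn : ∀ {n} → BipartiteGraph n → EdgeSet n → Set
MatchingIn G M = M ⊆ G × IsMatching M

Joined : ∀ {n} → BipartiteGraph n → Edge n → Edge n → Set
Joined G (a , b) (a′ , b′) = (a , b′) ∈ G ⊎ (a′ , b) ∈ G

IsInduced : ∀ {n} → BipartiteGraph n → EdgeSet n → Set
IsInduced G M = ∀ e f → e ∈ M → f ∈ M → ¬ (e ≡ f) → ¬ Joined G e f

Multitasker : ∀ {n} → ℕ → Cut → BipartiteGraph n → Set
Multitasker {n} k α G =
  (M : EdgeSet n) → MatchingIn G M → ∣ M ∣ ≡ k →
  Σ[ M′ ∈ EdgeSet n ]
    (M′ ⊆ M × MatchingIn G M′ × IsInduced G M′ × ∣ M ∣ · α ≤ʳ fromℕ ∣ M′ ∣)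

-- Contract every edge of the matching M to a vertex, joining two of these vertices if the edges
-- are joined in G; an induced submatching is an independent set of the contracted graph H.  In
-- the spirit of Shearer, a graph with v vertices and e edges without triangles and pentagons has
-- an independent set of size 2v/m − 2e/(m(m+2)) for every integer m ≥ 5: remove closed
-- neighbourhoods.  In terms of the average degree D of H this is the chord of v/(D − 2) between
-- D = m + 2 and D = m + 4, so if m < 1/α < m + 2, then D slightly above 2 + 1/α still gives αv.
-- A union bound shows that, with exponent exactly 1 + 4α, sets of k + k vertices spanning enough
-- edges to make D larger than that, as well as triangles and pentagons of H, can be avoided in a
-- sparse random graph G.  The random choice is derandomised by conditional expectations.
-- Finally, the real α is replaced by a rational i/Q just below it; what is lost there is made up
-- by the gap between the chord and the curve.
module Submission where

open import Data.Bool.Base using (Bool; true; false; T; not; if_then_else_; _∧_; _∨_)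
open import Data.Bool.Properties using (T?; ∨-comm)
open import Data.Empty using (⊥; ⊥-elim)
open import Data.Fin.Base using (Fin; zero; suc)
import Data.Fin.Properties as Fin
open import Data.Integer.Base as ℤ using (ℤ; -[1+_])
import Data.Integer.Properties as ℤ
open import Data.List.Base
  using (List; []; _∷_; _++_; map; length; filterᵇ; concatMap; allFin; cartesianProduct; take; tabulate; upTo)
import Data.List.Membership.DecPropositional as DecMembership
open import Data.List.Membership.Propositional using (find; lose) renaming (_∈_ to _∈ˡ_)
open import Data.List.Membership.Propositional.Properties
  using (∈-filter⁻; ∈-filter⁺; ∈-++⁻; ∈-++⁺ˡ; ∈-++⁺ʳ; ∈-map⁺; ∈-map⁻; ∈-concatMap⁺; ∈-concatMap⁻;
         ∈-cartesianProduct⁺; ∈-allFin; ∈-upTo⁺)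
open import Data.List.Properties using (filter-notAll; length-++; length-map; length-take; length-upTo; length-tabulate)
open import Data.List.Relation.Binary.Sublist.Propositional as Sublist
  using ([]; _∷_; _∷ʳ_) renaming (_⊆_ to _⊑_)
open import Data.List.Relation.Binary.Sublist.Propositional.Properties using (All-resp-⊆; filter-⊆)
open import Data.List.Relation.Unary.All as All using (All; []; _∷_)
open import Data.List.Relation.Unary.AllPairs using ([]; _∷_)
open import Data.List.Relation.Unary.Any using (Any; here; there; any?)
open import Data.List.Relation.Unary.Unique.Propositional using (Unique)
import Data.List.Relation.Unary.Unique.Propositional.Properties as Unique
open import Data.Nat.Base as ℕ hiding (_/_; _%_)
open import Data.Nat.DivMod using (m≡m%n+[m/n]*n; m%n<n; m/n*n≤m)
open import Data.Nat.Properties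
open import Algebra.Properties.CommutativeMonoid.Sum +-0-commutativeMonoid using (sum; ∑-comm)
open import Data.Nat.Tactic.RingSolver using (solve-∀)
open import Data.Product.Base using (_×_; _,_; ∃-syntax; Σ-syntax; proj₁; proj₂)
open import Data.Product.Properties using (≡-dec)
open import Data.Rational.Base as ℚ using (ℚ; mkℚ; 0ℚ; 1ℚ; ↥_; ↧_; ↧ₙ_; toℚᵘ)
import Data.Rational.Properties as ℚ
open import Data.Rational.Solver using (module +-*-Solver)
open import Data.Rational.Unnormalised.Base as ℚᵘ using (mkℚᵘ; *<*; *≤*; *≡*)
import Data.Rational.Unnormalised.Properties as ℚᵘ
open import Data.Sum.Base using (_⊎_; inj₁; inj₂; [_,_]′)
open import Function.Base using (_∘_; id)
open import Relation.Binary.Definitions using (DecidableEquality; tri<; tri≈; tri>)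
open import Relation.Binary.PropositionalEquality as ≡ using (_≡_; _≢_; refl; cong; cong₂; sym; subst)
open import Defs
  using (indicator; Edge; EdgeSet; BipartiteGraph; HasAverageDegree; ∣_∣; MatchingIn; IsMatching; IsInduced; Joined; _⊆_)
open import Relation.Nullary using (does; yes; no; Dec; contradiction; ¬_; ¬?; _×-dec_)

-- At a vertex of minimum degree δ, removing the closed neighbourhood suffices as soon as 2δ² -
-- 2(m+2)δ + (m+2)(m-2) ≥ 0. For m ≥ 6 this always holds, and only triangles have to be excluded.
-- For m = 5 it fails, by 3, at δ = 3 and δ = 4; these two degrees are what calls for excluding
-- pentagons. Both cycles are cheap to exclude: a triangle of H needs 6 edges of G on 3 + 3 vertices
-- and a pentagon 10 on 5 + 5, as many edges as vertices, so their expected number stays bounded as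
-- n grows. Dense blocks are expected at most once for each admissible k, hence at most n times in
-- all. This is why about 3dn random edges are enough to keep dn. The curve 1/(D - 2) is convex, so
-- it lies strictly below its chords in the interior. The chord spans two units because the
-- intervals (m, m + 2) with m ≥ 5 cover everything above 5, integers included; chords over one unit
-- would touch the curve whenever 1/α is an integer and leave no room for the rational
-- approximation.

private variable
  A B P : Set

-- Sums over lists

∑ : List A → (A → ℕ) → ℕ
∑ []       f = 0
∑ (x ∷ xs) f = f x + ∑ xs f

∑-cong : ∀ (xs : List A) {f g : A → ℕ} → (∀ x → f x ≡ g x) → ∑ xs f ≡ ∑ xs g
∑-cong []       f≗g = refl
∑-cong (x ∷ xs) f≗g = cong₂ _+_ (f≗g x) (∑-cong xs f≗g)

∑-mono : ∀ (xs : List A) {f g : A → ℕ} → (∀ x → x ∈ˡ xs → f x ≤ g x) → ∑ xs f ≤ ∑ xs g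
∑-mono []       f≤g = z≤n
∑-mono (x ∷ xs) f≤g = +-mono-≤ (f≤g x (here refl)) (∑-mono xs λ y → f≤g y ∘ there)

∑-+ : ∀ (xs : List A) (f g : A → ℕ) → ∑ xs (λ x → f x + g x) ≡ ∑ xs f + ∑ xs g
∑-+ []       f g = refl
∑-+ (x ∷ xs) f g = ≡.trans (cong (f x + g x +_) (∑-+ xs f g)) (shuffle (f x) (g x) _ _)
  where
  shuffle : ∀ a b c d → a + b + (c + d) ≡ a + c + (b + d)
  shuffle = solve-∀

∑-+₃ : ∀ (xs : List A) (f g h : A → ℕ) →
       ∑ xs (λ x → f x + (g x + h x)) ≡ ∑ xs f + (∑ xs g + ∑ xs h)
∑-+₃ xs f g h = ≡.trans (∑-+ xs f _) (cong (∑ xs f +_) (∑-+ xs g h))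

∑-* : ∀ (xs : List A) c (f : A → ℕ) → ∑ xs (λ x → c * f x) ≡ c * ∑ xs f
∑-* []       c f = sym (*-zeroʳ c)
∑-* (x ∷ xs) c f = ≡.trans (cong (c * f x +_) (∑-* xs c f)) (sym (*-distribˡ-+ c (f x) _))

∑-const : ∀ (xs : List A) c → ∑ xs (λ _ → c) ≡ length xs * c
∑-const []       c = refl
∑-const (x ∷ xs) c = cong (c +_) (∑-const xs c)

∑-one : ∀ (xs : List A) → ∑ xs (λ _ → 1) ≡ length xs
∑-one xs = ≡.trans (∑-const xs 1) (*-identityʳ _)

∑-swap : ∀ (xs : List A) (ys : List B) (f : A → B → ℕ) →
         ∑ xs (λ x → ∑ ys (f x)) ≡ ∑ ys (λ y → ∑ xs (λ x → f x y))
∑-swap []       ys f = sym (≡.trans (∑-const ys 0) (*-zeroʳ (length ys)))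
∑-swap (x ∷ xs) ys f = ≡.trans (cong (∑ ys (f x) +_) (∑-swap xs ys f)) (sym (∑-+ ys (f x) _))

∑-filter : ∀ (p : A → Bool) xs (f : A → ℕ) →
           ∑ (filterᵇ p xs) f ≡ ∑ xs (λ x → indicator (p x) * f x)
∑-filter p []       f = refl
∑-filter p (x ∷ xs) f with p x
... | true  = cong₂ _+_ (sym (+-identityʳ (f x))) (∑-filter p xs f)
... | false = ∑-filter p xs f

length-filterᵇ : ∀ (p : A → Bool) xs → length (filterᵇ p xs) ≡ ∑ xs (indicator ∘ p)
length-filterᵇ p xs = ≡.trans (sym (∑-one (filterᵇ p xs)))
  (≡.trans (∑-filter p xs _) (∑-cong xs λ x → *-identityʳ _))

∑-++ : ∀ (xs ys : List A) (f : A → ℕ) → ∑ (xs ++ ys) f ≡ ∑ xs f + ∑ ys f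
∑-++ []       ys f = refl
∑-++ (x ∷ xs) ys f = ≡.trans (cong (f x +_) (∑-++ xs ys f)) (sym (+-assoc (f x) _ _))

∑-map : ∀ (g : A → B) xs (f : B → ℕ) → ∑ (map g xs) f ≡ ∑ xs (f ∘ g)
∑-map g []       f = refl
∑-map g (x ∷ xs) f = cong (f (g x) +_) (∑-map g xs f)

∑-cartesianProduct : ∀ (xs : List A) (ys : List B) (f : A × B → ℕ) →
  ∑ (cartesianProduct xs ys) f ≡ ∑ xs (λ x → ∑ ys (λ y → f (x , y)))
∑-cartesianProduct []       ys f = refl
∑-cartesianProduct (x ∷ xs) ys f = ≡.trans (∑-++ (map (x ,_) ys) _ f)
  (cong₂ _+_ (∑-map (x ,_) ys f) (∑-cartesianProduct xs ys f))

-- Counting duplicate-free lists through indicator functions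

module Counting (_≟_ : DecidableEquality A) where
  open DecMembership _≟_ using (_∈?_)

  private
    δ : A → A → ℕ
    δ x y = indicator (does (x ≟ y))

  δ-refl : ∀ x → indicator (does (x ≟ x)) ≡ 1
  δ-refl x with x ≟ x
  ... | yes _   = refl
  ... | no  x≢x = contradiction refl x≢x

  ∑-δ-∉ : ∀ {xs y} → All (y ≢_) xs → ∑ xs (λ x → indicator (does (x ≟ y))) ≡ 0
  ∑-δ-∉ []            = refl
  ∑-δ-∉ {x ∷ xs} {y} (y≢x ∷ y∉xs) with x ≟ y
  ... | yes x≡y = contradiction (sym x≡y) y≢x
  ... | no  _   = ∑-δ-∉ y∉xs

  ∑-δ : ∀ {xs y} → Unique xs → y ∈ˡ xs → ∑ xs (λ x → indicator (does (x ≟ y))) ≡ 1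
  ∑-δ {x ∷ xs} (x∉xs ∷ _) (here refl) = cong₂ _+_ (δ-refl x) (∑-δ-∉ x∉xs)
  ∑-δ {x ∷ xs} {y} (x∉xs ∷ u) (there y∈xs) with x ≟ y
  ... | yes refl = contradiction refl (All.lookup x∉xs y∈xs)
  ... | no  _    = ∑-δ u y∈xs

  ∑-δ≤1 : ∀ {xs} y → Unique xs → ∑ xs (λ x → indicator (does (x ≟ y))) ≤ 1
  ∑-δ≤1 {xs} y u with y ∈? xs
  ... | yes y∈xs = ≤-reflexive (∑-δ u y∈xs)
  ... | no  y∉xs = ≤-trans (≤-reflexive (∑-δ-∉ (All.tabulate λ z∈xs y≡z → y∉xs (subst (_∈ˡ xs) (sym y≡z) z∈xs)))) z≤n

  indicator-∈≤ : ∀ x ys → indicator (does (x ∈? ys)) ≤ ∑ ys (λ y → indicator (does (x ≟ y)))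
  indicator-∈≤ x ys with x ∈? ys
  ... | no  _    = z≤n
  ... | yes x∈ys = go x∈ys
    where
    go : ∀ {zs} → x ∈ˡ zs → 1 ≤ ∑ zs (δ x)
    go {z ∷ zs} (here refl)  = ≤-trans (≤-reflexive (sym (δ-refl x))) (m≤m+n (δ x x) (∑ zs (δ x)))
    go {z ∷ zs} (there x∈zs) = ≤-trans (go x∈zs) (m≤n+m (∑ zs (δ x)) (δ x z))

  indicator-∈≥ : ∀ x {ys} → Unique ys → ∑ ys (λ y → indicator (does (x ≟ y))) ≤ indicator (does (x ∈? ys))
  indicator-∈≥ x {ys} u with x ∈? ys
  ... | yes x∈ys = ≤-trans (≤-reflexive (∑-cong ys δ-sym)) (∑-δ≤1 x u)
    where
    δ-sym : ∀ y → δ x y ≡ δ y x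
    δ-sym y with x ≟ y | y ≟ x
    ... | yes _   | yes _   = refl
    ... | no  _   | no  _   = refl
    ... | yes x≡y | no  y≢x = contradiction (sym x≡y) y≢x
    ... | no  x≢y | yes y≡x = contradiction (sym y≡x) x≢y
  ... | no  x∉ys = go x∉ys
    where
    go : ∀ {zs} → ¬ (x ∈ˡ zs) → ∑ zs (δ x) ≤ 0
    go {[]}     _ = z≤n
    go {z ∷ zs} x∉ with x ≟ z
    ... | yes x≡z = contradiction (here x≡z) x∉
    ... | no  _   = go (x∉ ∘ there)

  ∑-∈≤ : ∀ {xs} ys → Unique xs → ∑ xs (λ x → indicator (does (x ∈? ys))) ≤ length ys
  ∑-∈≤ {xs} ys u = begin
    ∑ xs (λ x → indicator (does (x ∈? ys))) ≤⟨ ∑-mono xs (λ x _ → indicator-∈≤ x ys) ⟩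
    ∑ xs (λ x → ∑ ys (λ y → δ x y))         ≡⟨ ∑-swap xs ys δ ⟩
    ∑ ys (λ y → ∑ xs (λ x → δ x y))         ≤⟨ ∑-mono ys (λ y _ → ∑-δ≤1 y u) ⟩
    ∑ ys (λ _ → 1)                          ≡⟨ ∑-one ys ⟩
    length ys                               ∎
    where open ≤-Reasoning

  ∑-∈≥ : ∀ {xs ys} → Unique xs → Unique ys → (∀ {y} → y ∈ˡ ys → y ∈ˡ xs) →
         length ys ≤ ∑ xs (λ x → indicator (does (x ∈? ys)))
  ∑-∈≥ {xs} {ys} u v ys⊆xs = begin
    length ys                               ≡⟨ ∑-one ys ⟨
    ∑ ys (λ _ → 1)                          ≤⟨ ∑-mono ys (λ y y∈ → ≤-reflexive (sym (∑-δ u (ys⊆xs y∈)))) ⟩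
    ∑ ys (λ y → ∑ xs (λ x → δ x y))         ≡⟨ ∑-swap xs ys δ ⟨
    ∑ xs (λ x → ∑ ys (λ y → δ x y))         ≤⟨ ∑-mono xs (λ x _ → indicator-∈≥ x v) ⟩
    ∑ xs (λ x → indicator (does (x ∈? ys))) ∎
    where open ≤-Reasoning

  ∑-∈ : ∀ {xs ys} → Unique xs → Unique ys → (∀ {y} → y ∈ˡ ys → y ∈ˡ xs) →
        ∑ xs (λ x → indicator (does (x ∈? ys))) ≡ length ys
  ∑-∈ {ys = ys} u v ys⊆xs = ≤-antisym (∑-∈≤ ys u) (∑-∈≥ u v ys⊆xs)

-- Independent sets in graphs without triangles and pentagons

∈-filterᵇ⁻ : ∀ (p : A → Bool) {x xs} → x ∈ˡ filterᵇ p xs → x ∈ˡ xs × T (p x)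
∈-filterᵇ⁻ p = ∈-filter⁻ (T? ∘ p)

argmin : ∀ (f : A → ℕ) x xs → ∃[ y ] (y ∈ˡ x ∷ xs × (∀ {z} → z ∈ˡ x ∷ xs → f y ≤ f z))
argmin f x []        = x , here refl , λ { (here refl) → ≤-refl }
argmin f x (x′ ∷ xs) with argmin f x′ xs
... | y , y∈ , y-min with ≤-total (f x) (f y)
...   | inj₁ fx≤fy = x , here refl , λ { (here refl) → ≤-refl ; (there z∈) → ≤-trans fx≤fy (y-min z∈) }
...   | inj₂ fy≤fx = y , there y∈ , λ { (here refl) → fy≤fx ; (there z∈) → y-min z∈ }

private
  keep : Bool → Bool → ℕ
  keep u j = indicator (not (u ∨ j))

  -- An ordered pair of adjacent vertices either survives, when both ends are kept, or is charged to
  -- an end in the removed neighbourhood. Two charges would need an edge inside that neighbourhood,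
  -- which the hypothesis excludes.
  edge-split : ∀ a u w j j′ → (T u → T w → T a → ⊥) →
    indicator a * (keep u j * keep w j′) + (indicator a * indicator u + indicator a * indicator w) ≤ indicator a
  edge-split false u     w     j     j′    _ = z≤n
  edge-split true  true  true  j     j′    h = ⊥-elim (h _ _ _)
  edge-split true  true  false j     j′    _ = ≤-refl
  edge-split true  false true  true  j′    _ = ≤-refl
  edge-split true  false true  false j′    _ = ≤-refl
  edge-split true  false false true  j′    _ = z≤n
  edge-split true  false false false true  _ = z≤n
  edge-split true  false false false false _ = ≤-refl

  vertex-split : ∀ u j → 1 ≤ keep u j + (indicator u + indicator j)
  vertex-split true  j     = s≤s z≤n
  vertex-split false true  = s≤s z≤n
  vertex-split false false = s≤s z≤n

  -- The difference is a quadratic in δ with discriminant 4(m+2)(6 - m), not positive for m ≥ 6.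
  -- Without subtraction: twice the inequality is `amgm` for m + 2 and 2δ, combined with 4 ≤ m - 2.
  large-m : ∀ {m} → 6 ≤ m → ∀ δ → 2 * (m + 2) * (δ + 1) ≤ m * (m + 2) + 2 * (δ * δ)
  large-m {m} 6≤m δ = *-cancelˡ-≤ 2 (begin
    2 * (2 * (m + 2) * (δ + 1))                             ≡⟨ expand m δ ⟩
    2 * ((m + 2) * (2 * δ)) + (m + 2) * 4                   ≤⟨ +-mono-≤ (amgm (m + 2) (2 * δ)) (*-monoʳ-≤ (m + 2) 4≤m∸2) ⟩
    (m + 2) * (m + 2) + 2 * δ * (2 * δ) + (m + 2) * (m ∸ 2) ≡⟨ rearrange (m + 2) (m ∸ 2) δ ⟩
    (m + 2) * ((m + 2) + (m ∸ 2)) + 4 * (δ * δ)             ≡⟨ cong (λ z → (m + 2) * z + 4 * (δ * δ)) 2m ⟩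
    (m + 2) * (2 * m) + 4 * (δ * δ)                         ≡⟨ collect m δ ⟩
    2 * (m * (m + 2) + 2 * (δ * δ))                         ∎)
    where
    open ≤-Reasoning
    expand : ∀ m δ → 2 * (2 * (m + 2) * (δ + 1)) ≡ 2 * ((m + 2) * (2 * δ)) + (m + 2) * 4
    expand = solve-∀
    collect : ∀ m δ → (m + 2) * (2 * m) + 4 * (δ * δ) ≡ 2 * (m * (m + 2) + 2 * (δ * δ))
    collect = solve-∀
    4≤m∸2 : 4 ≤ m ∸ 2
    4≤m∸2 = ∸-monoˡ-≤ 2 6≤m
    2m : (m + 2) + (m ∸ 2) ≡ 2 * m
    2m = ≡.trans (+-assoc m 2 (m ∸ 2))
      (≡.trans (cong (m +_) (m+[n∸m]≡n (≤-trans (s≤s (s≤s z≤n)) 6≤m))) (cong (m +_) (sym (+-identityʳ m))))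
    rearrange : ∀ a b c → a * a + 2 * c * (2 * c) + a * b ≡ a * (a + b) + 4 * (c * c)
    rearrange = solve-∀
    amgm : ∀ a b → 2 * (a * b) ≤ a * a + b * b
    amgm a b with ≤-total a b
    ... | inj₁ a≤b with k , refl ← m≤n⇒∃[o]m+o≡n a≤b = ≤-trans (m≤m+n _ (k * k)) (≤-reflexive (eq a k))
      where
      eq : ∀ a k → 2 * (a * (a + k)) + k * k ≡ a * a + (a + k) * (a + k)
      eq = solve-∀
    ... | inj₂ b≤a with k , refl ← m≤n⇒∃[o]m+o≡n b≤a = ≤-trans (m≤m+n _ (k * k)) (≤-reflexive (eq b k))
      where
      eq : ∀ b k → 2 * ((b + k) * b) + k * k ≡ (b + k) * (b + k) + b * b
      eq = solve-∀

  -- The quadratic is now 2δ² - 14δ + 21. It is -3 at δ = 3 and δ = 4, and positive at every other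
  -- natural number.
  five-away : ∀ δ → δ ≢ 3 → δ ≢ 4 → 14 * (δ + 1) ≤ 35 + 2 * (δ * δ)
  five-away 0 _ _ = m≤m+n 14 21
  five-away 1 _ _ = m≤m+n 28 9
  five-away 2 _ _ = m≤m+n 42 1
  five-away 3 ≢3 _ = contradiction refl ≢3
  five-away 4 _ ≢4 = contradiction refl ≢4
  five-away (suc (suc (suc (suc (suc e))))) _ _ = begin
    14 * (5 + e + 1)                             ≤⟨ m≤m+n _ (1 + 6 * e + 2 * (e * e)) ⟩
    14 * (5 + e + 1) + (1 + 6 * e + 2 * (e * e)) ≡⟨ expand e ⟩
    35 + 2 * ((5 + e) * (5 + e))                 ∎
    where
    open ≤-Reasoning
    expand : ∀ e → 14 * (5 + e + 1) + (1 + 6 * e + 2 * (e * e)) ≡ 35 + 2 * ((5 + e) * (5 + e))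
    expand = solve-∀

  at-five : ∀ {m} s j t → m ≡ 5 → 14 * s ≤ 35 * j + 2 * t → 2 * (m + 2) * s ≤ m * (m + 2) * j + 2 * t
  at-five s j t refl h = h

module IndependentSet
  {V : Set} (_≟ᵛ_ : DecidableEquality V) (adj : V → V → Bool)
  (adj-sym : ∀ u v → adj u v ≡ adj v u) (adj-irrefl : ∀ v → ¬ T (adj v v)) where

  open DecMembership _≟ᵛ_ using (_∈?_)
  open Counting _≟ᵛ_

  a : V → V → ℕ
  a u v = indicator (adj u v)

  deg : List V → V → ℕ
  deg L v = ∑ L (a v)

  degreeSum : List V → ℕ
  degreeSum L = ∑ L (deg L)

  neighbourDegrees : List V → V → ℕ
  neighbourDegrees L v = ∑ L (λ u → a u v * deg L u)

  -- `PentagonFree` forbids closed walks of length 5. In a loopless graph without triangles such a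
  -- walk repeats no vertex, so this amounts to having no 5-cycle, and no distinctness has to be
  -- shown when a pentagon is found.
  TriangleFree PentagonFree : List V → Set
  TriangleFree L = ∀ {x y z} → x ∈ˡ L → y ∈ˡ L → z ∈ˡ L →
    T (adj x y) → T (adj y z) → T (adj z x) → ⊥
  PentagonFree L = ∀ {v w x y z} → v ∈ˡ L → w ∈ˡ L → x ∈ˡ L → y ∈ˡ L → z ∈ˡ L →
    T (adj v w) → T (adj w x) → T (adj x y) → T (adj y z) → T (adj z v) → ⊥

  -- The linear lower bound 2n/m − 2e/(m(m+2)) on the independence number; in terms of the
  -- average degree D it is the chord of 1/(D − 2) between D = m + 2 and D = m + 4.
  record LargeIndependentSet (m : ℕ) (L : List V) : Set where
    field
      I           : List V
      unique      : Unique I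
      subset      : ∀ {x} → x ∈ˡ I → x ∈ˡ L
      independent : ∀ {x y} → x ∈ˡ I → y ∈ˡ I → ¬ T (adj x y)
      large       : 2 * (m + 2) * length L ≤ m * (m + 2) * length I + degreeSum L

  T-sym : ∀ {u v} → T (adj u v) → T (adj v u)
  T-sym {u} {v} = subst T (adj-sym u v)

  ∑-a : ∀ L v → ∑ L (λ u → a u v) ≡ deg L v
  ∑-a L v = ∑-cong L λ u → cong indicator (adj-sym u v)

  -- One removal step: `J` joins the independent set, and `J` leaves the graph together with `U`,
  -- which contains its neighbourhood. Independence of `U` means that no edge meets it twice, so
  -- that `UD` counts the lost edges without repetition.
  module _ {m : ℕ} {L : List V} (L-unique : Unique L) (J : List V) (J-unique : Unique J)
    (J⊆L : ∀ {x} → x ∈ˡ J → x ∈ˡ L)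
    (J-independent : ∀ {x y} → x ∈ˡ J → y ∈ˡ J → ¬ T (adj x y))
    (U : V → Bool) (N[J]⊆U : ∀ {v j} → j ∈ˡ J → T (adj v j) → T (U v))
    (U-independent : ∀ {v w} → v ∈ˡ L → w ∈ˡ L → T (U v) → T (U w) → ¬ T (adj v w))
    where

    private
      inJ : V → Bool
      inJ v = does (v ∈? J)

      u : V → ℕ
      u v = indicator (U v)

      k : V → ℕ
      k v = keep (U v) (inJ v)

      UD : ℕ
      UD = ∑ L (λ v → u v * deg L v)

    remainder : List V
    remainder = filterᵇ (λ v → not (U v ∨ inJ v)) L

    -- `UD` is subtracted twice because `degreeSum` counts every edge from both ends, while an edge
    -- meeting `U` has just one end there.
    degreeSum-remainder : degreeSum remainder + (UD + UD) ≤ degreeSum L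
    degreeSum-remainder = begin
      degreeSum remainder + (UD + UD)
        ≡⟨ cong₂ _+_ left (cong₂ _+_ right₁ right₂) ⟩
      ∑ L (λ v → ∑ L λ w → a v w * (k v * k w)) +
      (∑ L (λ v → ∑ L λ w → a v w * u v) + ∑ L (λ v → ∑ L λ w → a v w * u w))
        ≡⟨ join ⟨
      ∑ L (λ v → ∑ L λ w → a v w * (k v * k w) + (a v w * u v + a v w * u w))
        ≤⟨ ∑-mono L (λ v v∈ → ∑-mono L λ w w∈ →
             edge-split (adj v w) (U v) (U w) (inJ v) (inJ w) (U-independent v∈ w∈)) ⟩
      degreeSum L ∎
      where
      open ≤-Reasoning
      ac : ∀ x y z → x * (y * z) ≡ z * (x * y)
      ac = solve-∀
      left : degreeSum remainder ≡ ∑ L (λ v → ∑ L λ w → a v w * (k v * k w))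
      left = ≡.trans (∑-filter _ L _) (∑-cong L λ v →
        ≡.trans (cong (k v *_) (∑-filter _ L _))
        (≡.trans (sym (∑-* L (k v) _)) (∑-cong L λ w → ac (k v) (k w) (a v w))))
      right₁ : UD ≡ ∑ L (λ v → ∑ L λ w → a v w * u v)
      right₁ = ∑-cong L λ v → ≡.trans (sym (∑-* L (u v) _)) (∑-cong L λ w → *-comm (u v) (a v w))
      right₂ : UD ≡ ∑ L (λ v → ∑ L λ w → a v w * u w)
      right₂ = ≡.trans right₁ (≡.trans (∑-swap L L _) (∑-cong L λ v → ∑-cong L λ w →
        cong (λ b → indicator b * u w) (adj-sym w v)))
      join : ∑ L (λ v → ∑ L λ w → a v w * (k v * k w) + (a v w * u v + a v w * u w)) ≡
        ∑ L (λ v → ∑ L λ w → a v w * (k v * k w)) +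
        (∑ L (λ v → ∑ L λ w → a v w * u v) + ∑ L (λ v → ∑ L λ w → a v w * u w))
      join = ≡.trans (∑-cong L λ v → ∑-+₃ L (λ w → a v w * (k v * k w)) _ _) (∑-+₃ L _ _ _)

    length-remainder : length L ≤ length remainder + (∑ L u + length J)
    length-remainder = begin
      length L                                        ≡⟨ ∑-one L ⟨
      ∑ L (λ _ → 1)                                   ≤⟨ ∑-mono L (λ v _ → vertex-split (U v) (inJ v)) ⟩
      ∑ L (λ v → k v + (u v + indicator (inJ v)))     ≡⟨ ∑-+₃ L k u (indicator ∘ inJ) ⟩
      ∑ L k + (∑ L u + ∑ L (λ v → indicator (inJ v))) ≤⟨ +-mono-≤ (≤-reflexive (sym (length-filterᵇ _ L)))
                                                           (+-monoʳ-≤ (∑ L u) (∑-∈≤ J L-unique)) ⟩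
      length remainder + (∑ L u + length J)           ∎
      where open ≤-Reasoning

    remainder⊆L : ∀ {x} → x ∈ˡ remainder → x ∈ˡ L
    remainder⊆L = proj₁ ∘ ∈-filterᵇ⁻ _

    private
      split-not : ∀ b c → T (not (b ∨ c)) → ¬ T b × ¬ T c
      split-not false false _ = id , id

      remainder-avoids : ∀ {x} → x ∈ˡ remainder → ¬ T (U x) × ¬ T (inJ x)
      remainder-avoids {x} x∈ = split-not (U x) (inJ x) (proj₂ (∈-filterᵇ⁻ (λ v → not (U v ∨ inJ v)) {xs = L} x∈))

      T-inJ : ∀ {x} → x ∈ˡ J → T (inJ x)
      T-inJ {x} x∈J with x ∈? J
      ... | yes _   = _
      ... | no  x∉J = x∉J x∈J

    remainder-smaller : ∀ {x} → x ∈ˡ J → length remainder < length L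
    remainder-smaller {x} x∈J = filter-notAll _ L
      (lose (J⊆L x∈J) λ t → proj₂ (split-not (U x) (inJ x) t) (T-inJ x∈J))

    -- The target bound is linear, so it adds up over removal steps. The premise is the balance of a
    -- single step: the lost vertices are paid for by the new members of the independent set and by
    -- the lost degrees.
    extend : 2 * (m + 2) * (∑ L u + length J) ≤ m * (m + 2) * length J + 2 * UD →
             LargeIndependentSet m remainder → LargeIndependentSet m L
    extend gain S = record
      { I = J ++ I
      ; unique = Unique.++⁺ J-unique unique λ (x∈J , x∈I) → proj₂ (remainder-avoids (subset x∈I)) (T-inJ x∈J)
      ; subset = λ x∈ → [ J⊆L , remainder⊆L ∘ subset ]′ (∈-++⁻ J x∈)
      ; independent = indep
      ; large = begin
          M * length L
            ≤⟨ *-monoʳ-≤ M length-remainder ⟩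
          M * (length remainder + (∑ L u + length J))
            ≡⟨ *-distribˡ-+ M (length remainder) _ ⟩
          M * length remainder + M * (∑ L u + length J)
            ≤⟨ +-mono-≤ large gain ⟩
          K * length I + degreeSum remainder + (K * length J + 2 * UD)
            ≡⟨ shuffle K (length I) (length J) (degreeSum remainder) UD ⟩
          K * (length J + length I) + (degreeSum remainder + (UD + UD))
            ≤⟨ +-mono-≤ (≤-reflexive (cong (K *_) (sym (length-++ J)))) degreeSum-remainder ⟩
          K * length (J ++ I) + degreeSum L ∎
      }
      where
      open LargeIndependentSet S
      open ≤-Reasoning
      M K : ℕ
      M = 2 * (m + 2)
      K = m * (m + 2)
      shuffle : ∀ K i j e d → K * i + e + (K * j + 2 * d) ≡ K * (j + i) + (e + (d + d))
      shuffle = solve-∀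
      indep : ∀ {x y} → x ∈ˡ J ++ I → y ∈ˡ J ++ I → ¬ T (adj x y)
      indep x∈ y∈ xy with ∈-++⁻ J x∈ | ∈-++⁻ J y∈
      ... | inj₁ x∈J | inj₁ y∈J = J-independent x∈J y∈J xy
      ... | inj₁ x∈J | inj₂ y∈I = proj₁ (remainder-avoids (subset y∈I)) (N[J]⊆U x∈J (T-sym xy))
      ... | inj₂ x∈I | inj₁ y∈J = proj₁ (remainder-avoids (subset x∈I)) (N[J]⊆U y∈J xy)
      ... | inj₂ x∈I | inj₂ y∈I = independent x∈I y∈I xy

  neighbourDegrees-lower : ∀ L v c → (∀ {u} → u ∈ˡ L → T (adj u v) → c ≤ deg L u) →
    c * deg L v ≤ neighbourDegrees L v
  neighbourDegrees-lower L v c h = begin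
    c * deg L v             ≡⟨ cong (c *_) (∑-a L v) ⟨
    c * ∑ L (λ u → a u v)   ≡⟨ ∑-* L c _ ⟨
    ∑ L (λ u → c * a u v)   ≤⟨ ∑-mono L (λ u u∈ → pointwise (adj u v) (h u∈)) ⟩
    neighbourDegrees L v    ∎
    where
    open ≤-Reasoning
    pointwise : ∀ b {d} → (T b → c ≤ d) → c * indicator b ≤ indicator b * d
    pointwise true  c≤d = ≤-trans (≤-reflexive (*-identityʳ c)) (≤-trans (c≤d _) (≤-reflexive (sym (+-identityʳ _))))
    pointwise false _   = ≤-reflexive (*-zeroʳ c)

  -- Meant for a neighbour `v` of the vertex `x` of minimum degree: only `x` itself may fall short
  -- of `c`, and only by one.
  neighbourDegrees-lower′ : ∀ {L} v x c → Unique L →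
    (∀ {u} → u ∈ˡ L → T (adj u v) → c ≤ suc (deg L u)) →
    (∀ {u} → u ∈ˡ L → u ≢ x → T (adj u v) → c ≤ deg L u) →
    c * deg L v ≤ neighbourDegrees L v + 1
  neighbourDegrees-lower′ {L} v x c L-unique h h′ = begin
    c * deg L v             ≡⟨ cong (c *_) (∑-a L v) ⟨
    c * ∑ L (λ u → a u v)   ≡⟨ ∑-* L c _ ⟨
    ∑ L (λ u → c * a u v)   ≤⟨ ∑-mono L (λ u u∈ → pointwise u u∈) ⟩
    ∑ L (λ u → a u v * deg L u + indicator (does (u ≟ᵛ x))) ≡⟨ ∑-+ L _ _ ⟩
    neighbourDegrees L v + ∑ L (λ u → indicator (does (u ≟ᵛ x))) ≤⟨ +-monoʳ-≤ _ (∑-δ≤1 x L-unique) ⟩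
    neighbourDegrees L v + 1 ∎
    where
    open ≤-Reasoning
    pointwise : ∀ u → u ∈ˡ L → c * a u v ≤ a u v * deg L u + indicator (does (u ≟ᵛ x))
    pointwise u u∈ with adj u v | h u∈ | h′ u∈
    ... | false | _ | _ = ≤-trans (≤-reflexive (*-zeroʳ c)) z≤n
    ... | true  | c≤ | c≤′ with u ≟ᵛ x
    ...   | yes _  = ≤-trans (≤-reflexive (*-identityʳ c)) (≤-trans (c≤ _) (≤-reflexive (eq (deg L u))))
      where
      eq : ∀ d → suc d ≡ 1 * d + 1
      eq = solve-∀
    ...   | no u≢x = ≤-trans (≤-reflexive (*-identityʳ c)) (≤-trans (c≤′ u≢x _) (≤-reflexive (eq (deg L u))))
      where
      eq : ∀ d → d ≡ 1 * d + 0
      eq = solve-∀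

  -- Removing closed neighbourhoods of a vertex of minimum degree δ suffices unless m = 5 and
  -- δ ∈ {3, 4}.  In that case one removes the closed neighbourhood of two vertices of degree δ
  -- with a common neighbour; if there are none, then some neighbourhood has a large degree sum.
  module Step {m : ℕ} {L : List V} (5≤m : 5 ≤ m) (L! : Unique L) (△-free : TriangleFree L) (⬠-free : PentagonFree L)
    (recurse : ∀ L′ → length L′ < length L → Unique L′ → (∀ {x} → x ∈ˡ L′ → x ∈ˡ L) →
               LargeIndependentSet m L′)
    {x} (x∈ : x ∈ˡ L) (δ-min : ∀ {z} → z ∈ˡ L → deg L x ≤ deg L z) where

    open ≤-Reasoning

    δ : ℕ
    δ = deg L x

    single : ∀ {v} → v ∈ˡ L → 2 * (m + 2) * (deg L v + 1) ≤ m * (m + 2) * 1 + 2 * neighbourDegrees L v →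
             LargeIndependentSet m L
    single {v} v∈ gain = extend L! J J! J⊆L J-ind U N⊆U U-ind
      (≤-trans (≤-reflexive (cong (λ d → 2 * (m + 2) * (d + 1)) (∑-a L v)))
        gain)
      (recurse _ (remainder-smaller {m} L! J J! J⊆L J-ind U N⊆U U-ind (here refl))
        (Unique.filter⁺ (T? ∘ λ v → not (U v ∨ does (v ∈? J))) L!) (remainder⊆L {m} L! J J! J⊆L J-ind U N⊆U U-ind))
      where
      J : List V
      J = v ∷ []
      J! : Unique J
      J! = [] ∷ []
      J⊆L : ∀ {x} → x ∈ˡ J → x ∈ˡ L
      J⊆L (here refl) = v∈
      J-ind : ∀ {x y} → x ∈ˡ J → y ∈ˡ J → ¬ T (adj x y)
      J-ind (here refl) (here refl) = adj-irrefl v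
      U : V → Bool
      U u = adj u v
      N⊆U : ∀ {u j} → j ∈ˡ J → T (adj u j) → T (U u)
      N⊆U (here refl) t = t
      U-ind : ∀ {u w} → u ∈ˡ L → w ∈ˡ L → T (U u) → T (U w) → ¬ T (adj u w)
      U-ind u∈ w∈ uv wv uw = △-free u∈ w∈ v∈ uw wv (T-sym uv)

    T-∨⁺ˡ : ∀ {b c} → T b → T (b ∨ c)
    T-∨⁺ˡ {true} _ = _
    T-∨⁺ʳ : ∀ {b c} → T c → T (b ∨ c)
    T-∨⁺ʳ {true}  _ = _
    T-∨⁺ʳ {false} t = t
    T-∨⁻ : ∀ b {c} → T (b ∨ c) → T b ⊎ T c
    T-∨⁻ true  t = inj₁ t
    T-∨⁻ false t = inj₂ t

    -- For u in N(x) and w in N(y), an edge u w would close the pentagon x u w y z, so N(x) ∪ N(y)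
    -- is independent. The common neighbour `z` is counted in both degrees, which saves one vertex.
    pair : ∀ {x y z} → x ∈ˡ L → y ∈ˡ L → z ∈ˡ L → y ≢ x → T (adj z x) → T (adj z y) →
           (∀ n → n + 1 ≤ deg L x + deg L y → ∀ D → (∀ c → (∀ {u} → u ∈ˡ L → c ≤ deg L u) → c * n ≤ D) →
             2 * (m + 2) * (n + 2) ≤ m * (m + 2) * 2 + 2 * D) →
           LargeIndependentSet m L
    pair {x} {y} {z} x∈ y∈ z∈ y≢x zx zy gain = extend L! J J! J⊆L J-ind U N⊆U U-ind
      (gain _ count _ λ c h → ≤-trans (≤-reflexive (sym (∑-* L c _))) (∑-mono L λ u u∈ →
        ≤-trans (*-monoˡ-≤ (indicator (U u)) (h u∈)) (≤-reflexive (*-comm (deg L u) _))))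
      (recurse _ (remainder-smaller {m} L! J J! J⊆L J-ind U N⊆U U-ind (here refl))
        (Unique.filter⁺ (T? ∘ λ v → not (U v ∨ does (v ∈? J))) L!) (remainder⊆L {m} L! J J! J⊆L J-ind U N⊆U U-ind))
      where
      J : List V
      J = x ∷ y ∷ []
      J! : Unique J
      J! = ((y≢x ∘ sym) ∷ []) ∷ ([] ∷ [])
      J⊆L : ∀ {v} → v ∈ˡ J → v ∈ˡ L
      J⊆L (here refl) = x∈
      J⊆L (there (here refl)) = y∈
      x≁y : ¬ T (adj x y)
      x≁y xy = △-free x∈ y∈ z∈ xy (T-sym zy) zx
      J-ind : ∀ {v w} → v ∈ˡ J → w ∈ˡ J → ¬ T (adj v w)
      J-ind (here refl)         (here refl)         = adj-irrefl x
      J-ind (here refl)         (there (here refl)) = x≁y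
      J-ind (there (here refl)) (here refl)         = x≁y ∘ T-sym
      J-ind (there (here refl)) (there (here refl)) = adj-irrefl y
      U : V → Bool
      U u = adj u x ∨ adj u y
      N⊆U : ∀ {u j} → j ∈ˡ J → T (adj u j) → T (U u)
      N⊆U (here refl)         = T-∨⁺ˡ
      N⊆U {u} (there (here refl)) = T-∨⁺ʳ {adj u x}
      U-ind : ∀ {u w} → u ∈ˡ L → w ∈ˡ L → T (U u) → T (U w) → ¬ T (adj u w)
      U-ind {u} {w} u∈ w∈ Uu Uw uw with T-∨⁻ (adj u x) Uu | T-∨⁻ (adj w x) Uw
      ... | inj₁ ux | inj₁ wx = △-free u∈ w∈ x∈ uw wx (T-sym ux)
      ... | inj₂ uy | inj₂ wy = △-free u∈ w∈ y∈ uw wy (T-sym uy)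
      ... | inj₁ ux | inj₂ wy = ⬠-free x∈ u∈ w∈ y∈ z∈ (T-sym ux) uw wy (T-sym zy) zx
      ... | inj₂ uy | inj₁ wx = ⬠-free y∈ u∈ w∈ x∈ z∈ (T-sym uy) uw wx (T-sym zx) zy
      count : ∑ L (λ u → indicator (U u)) + 1 ≤ deg L x + deg L y
      count = begin
        ∑ L (λ u → indicator (U u)) + 1
          ≡⟨ cong (∑ L (λ u → indicator (U u)) +_) (sym (∑-δ L! z∈)) ⟩
        ∑ L (λ u → indicator (U u)) + ∑ L (λ u → indicator (does (u ≟ᵛ z)))
          ≡⟨ ∑-+ L (indicator ∘ U) _ ⟨
        ∑ L (λ u → indicator (U u) + indicator (does (u ≟ᵛ z)))
          ≤⟨ ∑-mono L (λ u _ → pointwise u) ⟩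
        ∑ L (λ u → a u x + a u y)
          ≡⟨ ≡.trans (∑-+ L (λ u → a u x) _) (cong₂ _+_ (∑-a L x) (∑-a L y)) ⟩
        deg L x + deg L y ∎
        where
        both : ∀ b c → T b → T c → indicator (b ∨ c) + 1 ≤ indicator b + indicator c
        both true true _ _ = ≤-refl
        union : ∀ b c → indicator (b ∨ c) + 0 ≤ indicator b + indicator c
        union true  c = s≤s z≤n
        union false c = ≤-reflexive (+-identityʳ _)
        pointwise : ∀ u → indicator (U u) + indicator (does (u ≟ᵛ z)) ≤ a u x + a u y
        pointwise u with u ≟ᵛ z
        ... | yes refl = both (adj u x) (adj u y) zx zy
        ... | no  _    = union (adj u x) (adj u y)

    δ² : δ * δ ≤ neighbourDegrees L x
    δ² = neighbourDegrees-lower L x δ λ u∈ _ → δ-min u∈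

    TwinOf : V → Set
    TwinOf y = y ≢ x × deg L y ≡ δ × Any (λ u → T (adj u x) × T (adj u y)) L

    twin? : Dec (Any TwinOf L)
    twin? = any? (λ y → ¬? (y ≟ᵛ x) ×-dec (deg L y ≟ δ) ×-dec any? (λ u → T? (adj u x) ×-dec T? (adj u y)) L) L

    exceptional : m ≡ 5 → δ ≡ 3 ⊎ δ ≡ 4 → LargeIndependentSet m L
    exceptional m≡5 δ-cases = by-twin twin?
      where
      -- The claim reduces to 8n ≤ 42 for δ = 3 and to 6n ≤ 42 for δ = 4. Both hold up to n = 2δ - 1
      -- and both fail at n = 2δ: the vertex saved by the common neighbour is decisive.
      pair-gain : ∀ n {D} → n + 1 ≤ δ + δ → δ * n ≤ D → 14 * (n + 2) ≤ 35 * 2 + 2 * D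
      pair-gain n {D} n< δn≤D = ≤-trans (numeric δ-cases) (+-monoʳ-≤ 70 (*-monoʳ-≤ 2 δn≤D))
        where
        split₃ : ∀ n → 14 * (n + 2) ≡ 8 * (n + 1) + (20 + 6 * n)
        split₃ = solve-∀
        join₃ : ∀ n → 2 + (48 + (20 + 6 * n)) ≡ 70 + 2 * (3 * n)
        join₃ = solve-∀
        split₄ : ∀ n → 14 * (n + 2) ≡ 6 * (n + 1) + (22 + 8 * n)
        split₄ = solve-∀
        join₄ : ∀ n → 48 + (22 + 8 * n) ≡ 70 + 2 * (4 * n)
        join₄ = solve-∀
        numeric : δ ≡ 3 ⊎ δ ≡ 4 → 14 * (n + 2) ≤ 70 + 2 * (δ * n)
        numeric (inj₁ δ≡3) = begin
          14 * (n + 2)               ≡⟨ split₃ n ⟩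
          8 * (n + 1) + (20 + 6 * n) ≤⟨ +-monoˡ-≤ _ (*-monoʳ-≤ 8 (subst (λ d → n + 1 ≤ d + d) δ≡3 n<)) ⟩
          48 + (20 + 6 * n)          ≤⟨ m≤n+m _ 2 ⟩
          2 + (48 + (20 + 6 * n))    ≡⟨ join₃ n ⟩
          70 + 2 * (3 * n)           ≡⟨ cong (λ d → 70 + 2 * (d * n)) δ≡3 ⟨
          70 + 2 * (δ * n)           ∎
        numeric (inj₂ δ≡4) = begin
          14 * (n + 2)               ≡⟨ split₄ n ⟩
          6 * (n + 1) + (22 + 8 * n) ≤⟨ +-monoˡ-≤ _ (*-monoʳ-≤ 6 (subst (λ d → n + 1 ≤ d + d) δ≡4 n<)) ⟩
          48 + (22 + 8 * n)          ≡⟨ join₄ n ⟩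
          70 + 2 * (4 * n)           ≡⟨ cong (λ d → 70 + 2 * (d * n)) δ≡4 ⟨
          70 + 2 * (δ * n)           ∎

      -- The neighbouring degrees exceed δ² by at least δ - 1 ≥ 2 in total, and twice that covers
      -- the deficit 3.
      single-gain : ∀ {d S} → d ≡ δ → suc δ * d ≤ S + 1 → 14 * (d + 1) ≤ 35 * 1 + 2 * S
      single-gain {S = S} refl lower = numeric δ-cases lower
        where
        numeric : ∀ {d} → d ≡ 3 ⊎ d ≡ 4 → suc d * d ≤ S + 1 → 14 * (d + 1) ≤ 35 + 2 * S
        numeric (inj₁ refl) h = ≤-trans (m≤n+m 56 1) (+-monoʳ-≤ 35 (*-monoʳ-≤ 2 (s≤s⁻¹ (≤-trans h (≤-reflexive (+-comm S 1))))))
        numeric (inj₂ refl) h = ≤-trans (m≤n+m 70 3) (+-monoʳ-≤ 35 (*-monoʳ-≤ 2 (s≤s⁻¹ (≤-trans h (≤-reflexive (+-comm S 1))))))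

      by-neighbour : ¬ Any TwinOf L → Dec (Any (λ u → T (adj u x) × deg L u ≡ δ) L) → LargeIndependentSet m L
      by-neighbour no-twin (yes found) with find found
      ... | u , u∈ , ux , du = single u∈ (at-five (deg L u + 1) 1 (neighbourDegrees L u) m≡5 (single-gain du lower))
        where
        lower : suc δ * deg L u ≤ neighbourDegrees L u + 1
        -- A neighbour w ≠ x of u has u in common with x, so degree δ would make it a twin of x.
        lower = neighbourDegrees-lower′ u x (suc δ) L! (λ w∈ _ → s≤s (δ-min w∈)) λ w∈ w≢x wu →
          ≤∧≢⇒< (δ-min w∈) λ δ≡ → no-twin (lose w∈ (w≢x , sym δ≡ , lose u∈ (ux , T-sym wu)))
      by-neighbour no-twin (no none) = single x∈ (at-five (δ + 1) 1 (neighbourDegrees L x) m≡5 (single-gain refl (≤-trans lower (m≤m+n _ 1))))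
        where
        lower : suc δ * δ ≤ neighbourDegrees L x
        lower = neighbourDegrees-lower L x (suc δ) λ u∈ ux →
          ≤∧≢⇒< (δ-min u∈) λ δ≡ → none (lose u∈ (ux , sym δ≡))

      by-twin : Dec (Any TwinOf L) → LargeIndependentSet m L
      by-twin (no no-twin) = by-neighbour no-twin (any? (λ u → T? (adj u x) ×-dec (deg L u ≟ δ)) L)
      by-twin (yes twin) with find twin
      ... | y , y∈ , y≢x , dy , common with find common
      ...   | z , z∈ , zx , zy = pair x∈ y∈ z∈ y≢x zx zy λ n n<2δ D bound →
                at-five (n + 2) 2 D m≡5 (pair-gain n (≤-trans n<2δ (≤-reflexive (cong (δ +_) dy))) (bound δ δ-min))

    result : LargeIndependentSet m L
    result with m≤n⇒m<n∨m≡n 5≤m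
    ... | inj₁ 6≤m = single x∈ (≤-trans (large-m 6≤m δ)
                       (+-mono-≤ (≤-reflexive (sym (*-identityʳ (m * (m + 2))))) (*-monoʳ-≤ 2 δ²)))
    ... | inj₂ 5≡m with δ ≟ 3 | δ ≟ 4
    ...   | yes δ≡3 | _       = exceptional (sym 5≡m) (inj₁ δ≡3)
    ...   | no  _   | yes δ≡4 = exceptional (sym 5≡m) (inj₂ δ≡4)
    ...   | no  δ≢3 | no  δ≢4 = single x∈ (at-five (δ + 1) 1 (neighbourDegrees L x) (sym 5≡m)
                                  (≤-trans (five-away δ δ≢3 δ≢4) (+-monoʳ-≤ 35 (*-monoʳ-≤ 2 δ²))))

  independentSet : ∀ m → 5 ≤ m → ∀ L → Unique L → TriangleFree L → PentagonFree L →
                   LargeIndependentSet m L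
  independentSet m 5≤m L = go (length L) L ≤-refl
    where
    go : ∀ s L → length L ≤ s → Unique L → TriangleFree L → PentagonFree L → LargeIndependentSet m L
    go s [] _ _ _ _ = record
      { I = [] ; unique = [] ; subset = λ () ; independent = λ ()
      ; large = ≤-trans (≤-reflexive (*-zeroʳ (2 * (m + 2)))) z≤n }
    go (suc s) L@(v₀ ∷ L₀) L≤s L! △-free ⬠-free =
      let x , x∈ , x-min = argmin (deg L) v₀ L₀ in
      Step.result 5≤m L! △-free ⬠-free
        (λ L′ L′<L L′! ⊆L → go s L′ (s≤s⁻¹ (≤-trans L′<L L≤s)) L′!
          (λ p q r → △-free (⊆L p) (⊆L q) (⊆L r))
          (λ p q r t w → ⬠-free (⊆L p) (⊆L q) (⊆L r) (⊆L t) (⊆L w)))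
        x∈ x-min

-- Sparse sets avoiding a given family

term≤∑ : ∀ {xs : List A} {x} (f : A → ℕ) → x ∈ˡ xs → f x ≤ ∑ xs f
term≤∑ {xs = x ∷ xs} f (here refl) = m≤m+n (f x) (∑ xs f)
term≤∑ {xs = y ∷ xs} f (there x∈)  = ≤-trans (term≤∑ f x∈) (m≤n+m (∑ xs f) (f y))

module Greedy {V : Set} (q : ℕ) .{{_ : NonZero q}} where

  -- q ^ |vs ∖ F|, that is q ^ |vs| times the probability that F is contained in a random
  -- subset of vs with density 1 / q.
  weight : List V → (V → Bool) → ℕ
  weight []       F = 1
  weight (v ∷ vs) F = (if F v then 1 else q) * weight vs F

  weight-avoid : ∀ {vs F} → ¬ Any (T ∘ F) vs → weight vs F ≡ q ^ length vs
  weight-avoid {[]}         _ = refl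
  weight-avoid {v ∷ vs} {F} avoid with F v in eq
  ... | true  = contradiction (here (subst T (sym eq) _)) avoid
  ... | false = cong (q *_) (weight-avoid (avoid ∘ there))

  -- With denominators cleared, `large` says |S| ≥ |vs|/q - Σ Pr[F chosen], the size promised by the
  -- deletion method. In `independent` only the part of `F` inside `vs` counts, since the recursion
  -- sees no more of it.
  record Independent (vs : List V) (Fs : List (V → Bool)) : Set where
    field
      S           : List V
      unique      : Unique S
      subset      : ∀ {v} → v ∈ˡ S → v ∈ˡ vs
      independent : ∀ {F} → F ∈ˡ Fs → ¬ (∀ {v} → v ∈ˡ vs → T (F v) → v ∈ˡ S)
      large       : q ^ length vs * length vs ≤ q ^ length vs * q * length S + q * ∑ Fs (weight vs)

  private
    -- Let `p` be q to the number of elements left and `X₁` the weight of the sets through `v`.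
    -- Compared with the average, taking `v` earns 1 - 1/q of an element and costs (1 - 1/q) X₁ / p.
    include : ∀ q .{{_ : NonZero q}} p n s X₀ X₁ → X₁ ≤ p → p * n ≤ p * q * s + q * (X₀ + X₁) →
              q * p * suc n ≤ q * p * q * suc s + q * (q * X₀ + X₁)
    include q@(suc r) p n s X₀ X₁ X₁≤p h = begin
      q * p * suc n                                      ≡⟨ e₁ r p n ⟩
      q * (p * n) + (1 + r) * p                          ≤⟨ +-monoˡ-≤ _ (*-monoʳ-≤ q h) ⟩
      q * (p * q * s + q * (X₀ + X₁)) + (1 + r) * p      ≡⟨ e₂ r p s X₀ X₁ ⟩
      (1 + r) * r * X₁ + (q * p * q * s + q * (q * X₀ + X₁) + (1 + r) * p)
                                                         ≤⟨ +-monoˡ-≤ _ (*-monoʳ-≤ ((1 + r) * r) X₁≤p) ⟩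
      (1 + r) * r * p + (q * p * q * s + q * (q * X₀ + X₁) + (1 + r) * p)
                                                         ≡⟨ e₃ r p s X₀ X₁ ⟩
      q * p * q * suc s + q * (q * X₀ + X₁)              ∎
      where
      open ≤-Reasoning
      e₁ : ∀ r p n → (1 + r) * p * (1 + n) ≡ (1 + r) * (p * n) + (1 + r) * p
      e₁ = solve-∀
      e₂ : ∀ r p s x y → (1 + r) * (p * (1 + r) * s + (1 + r) * (x + y)) + (1 + r) * p ≡
        (1 + r) * r * y + ((1 + r) * p * (1 + r) * s + (1 + r) * ((1 + r) * x + y) + (1 + r) * p)
      e₂ = solve-∀
      e₃ : ∀ r p s x y → (1 + r) * r * p + ((1 + r) * p * (1 + r) * s + (1 + r) * ((1 + r) * x + y) + (1 + r) * p) ≡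
        (1 + r) * p * (1 + r) * (1 + s) + (1 + r) * ((1 + r) * x + y)
      e₃ = solve-∀

    -- Skipping `v` loses the 1/q that it contributes on average and clears X₁ / (q p) of the
    -- expected number of violations.
    exclude : ∀ q p n s X₀ X₁ → p ≤ X₁ → p * n ≤ p * q * s + q * X₀ →
              q * p * suc n ≤ q * p * q * s + q * (q * X₀ + X₁)
    exclude q p n s X₀ X₁ p≤X₁ h = begin
      q * p * suc n                              ≡⟨ e₁ q p n ⟩
      q * (p * n) + q * p                        ≤⟨ +-mono-≤ (*-monoʳ-≤ q h) (*-monoʳ-≤ q p≤X₁) ⟩
      q * (p * q * s + q * X₀) + q * X₁          ≡⟨ e₂ q p s X₀ X₁ ⟩
      q * p * q * s + q * (q * X₀ + X₁)          ∎
      where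
      open ≤-Reasoning
      e₁ : ∀ q p n → q * p * (1 + n) ≡ q * (p * n) + q * p
      e₁ = solve-∀
      e₂ : ∀ q p s x y → q * (p * q * s + q * x) + q * y ≡ q * p * q * s + q * (q * x + y)
      e₂ = solve-∀

  private
    unit : ∀ b → T b → ∀ x → x ≡ indicator b * x
    unit true _ x = sym (+-identityʳ x)

  private module Split (v : V) (vs : List V) (Fs : List (V → Bool)) where
    through avoiding : (V → Bool) → ℕ
    through  F = indicator (F v) * weight vs F
    avoiding F = indicator (not (F v)) * weight vs F
    X₁ X₀ : ℕ
    X₁ = ∑ Fs through
    X₀ = ∑ Fs avoiding
    total : ∑ Fs (weight (v ∷ vs)) ≡ q * X₀ + X₁
    total = ≡.trans (∑-cong Fs pointwise) (≡.trans (∑-+ Fs (λ F → q * avoiding F) through)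
      (cong (_+ X₁) (∑-* Fs q avoiding)))
      where
      pointwise : ∀ F → weight (v ∷ vs) F ≡ q * avoiding F + through F
      pointwise F with F v
      ... | true  = cong (_+ 1 * weight vs F) (sym (*-zeroʳ q))
      ... | false = sym (≡.trans (+-identityʳ _) (cong (q *_) (+-identityʳ _)))
    rest : ∑ Fs (weight vs) ≡ X₀ + X₁
    rest = ≡.trans (∑-cong Fs pointwise) (∑-+ Fs avoiding through)
      where
      pointwise : ∀ F → weight vs F ≡ avoiding F + through F
      pointwise F with F v
      ... | true  = sym (+-identityʳ _)
      ... | false = sym (≡.trans (+-identityʳ _) (+-identityʳ _))

  -- Conditional expectations: v is included exactly if the members of Fs through v are
  -- together less likely than 1.  Then no member of Fs is ever completed.
  greedy : ∀ vs Fs → Unique vs → (∀ {F} → F ∈ˡ Fs → Any (T ∘ F) vs) → Independent vs Fs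
  greedy [] Fs _ nonempty = record
    { S = [] ; unique = [] ; subset = λ ()
    ; independent = λ F∈ _ → contradiction (nonempty F∈) λ ()
    ; large = z≤n }
  greedy (v ∷ vs) Fs (v∉vs ∷ vs!) nonempty with <-≤-connex (Split.X₁ v vs Fs) (q ^ length vs)
  ... | inj₁ X₁< = record
    { S = v ∷ S
    ; unique = All.tabulate (λ u∈S → All.lookup v∉vs (subset u∈S)) ∷ unique
    ; subset = λ { (here refl) → here refl ; (there u∈) → there (subset u∈) }
    ; independent = λ F∈ F⊆ → independent F∈ λ u∈ Fu → tail-∈ u∈ (F⊆ (there u∈) Fu)
    ; large = ≤-trans (include q _ (length vs) (length S) (X₀) (X₁) (<⇒≤ X₁<)
        (≤-trans large (≤-reflexive (cong (λ z → q ^ length vs * q * length S + q * z) rest))))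
        (≤-reflexive (cong (λ z → q * q ^ length vs * q * suc (length S) + q * z) (sym total)))
    }
    where
    open Split v vs Fs
    nonempty′ : ∀ {F} → F ∈ˡ Fs → Any (T ∘ F) vs
    nonempty′ {F} F∈ with any? (T? ∘ F) vs | nonempty F∈
    ... | yes any  | _         = any
    ... | no  _    | there any = any
    -- If `v` were the last element of `F` still undecided, the weight of `F` alone would reach q ^
    -- |vs|, against `X₁<`.
    ... | no avoid | here Fv   = contradiction X₁< (≤⇒≯ (≤-trans (≤-reflexive eq) (term≤∑ through F∈)))
      where
      eq : q ^ length vs ≡ through F
      eq = ≡.trans (sym (weight-avoid avoid)) (unit (F v) Fv (weight vs F))
    open Independent (greedy vs Fs vs! nonempty′)
    tail-∈ : ∀ {u} → u ∈ˡ vs → u ∈ˡ v ∷ S → u ∈ˡ S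
    tail-∈ u∈ (here refl) = contradiction refl (All.lookup v∉vs u∈)
    tail-∈ u∈ (there u∈S) = u∈S
  ... | inj₂ ≤X₁ = record
    { S = S
    ; unique = unique
    ; subset = there ∘ subset
    ; independent = indep
    ; large = ≤-trans (exclude q _ (length vs) (length S) X₀ X₁ ≤X₁
        (≤-trans large (≤-reflexive (cong (λ z → q ^ length vs * q * length S + q * z) (∑-filter _ Fs _)))))
        (≤-reflexive (cong (λ z → q * q ^ length vs * q * length S + q * z) (sym total)))
    }
    where
    open Split v vs Fs
    Fs₀ : List (V → Bool)
    Fs₀ = filterᵇ (λ F → not (F v)) Fs
    nonempty′ : ∀ {F} → F ∈ˡ Fs₀ → Any (T ∘ F) vs
    nonempty′ {F} F∈ with ∈-filterᵇ⁻ (λ F → not (F v)) {xs = Fs} F∈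
    ... | F∈Fs , ¬Fv with F v in eq | nonempty F∈Fs
    ...   | false | here Fv   = contradiction (subst T eq Fv) id
    ...   | false | there any = any
    open Independent (greedy vs Fs₀ vs! nonempty′)
    indep : ∀ {F} → F ∈ˡ Fs → ¬ (∀ {u} → u ∈ˡ v ∷ vs → T (F u) → u ∈ˡ S)
    indep {F} F∈ F⊆ with F v in eq
    ... | true  = contradiction refl (All.lookup v∉vs (subset (F⊆ (here refl) (subst T (sym eq) _))))
    ... | false = independent (∈-filter⁺ (T? ∘ λ F → not (F v)) F∈ (subst (T ∘ not) (sym eq) _)) (F⊆ ∘ there)

-- Counting subsets

^-distribʳ-* : ∀ o m n → (m * n) ^ o ≡ m ^ o * n ^ o
^-distribʳ-* zero    m n = refl
^-distribʳ-* (suc o) m n = ≡.trans (cong (m * n *_) (^-distribʳ-* o m n)) (shuffle m n (m ^ o) (n ^ o))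
  where
  shuffle : ∀ m n a b → m * n * (a * b) ≡ m * a * (n * b)
  shuffle = solve-∀

^-cancelʳ-≤ : ∀ o .{{_ : NonZero o}} m n → m ^ o ≤ n ^ o → m ≤ n
^-cancelʳ-≤ o m n mᵒ≤nᵒ with m ≤? n
... | yes m≤n = m≤n
... | no  m≰n = contradiction mᵒ≤nᵒ (<⇒≱ (^-monoˡ-< o (≰⇒> m≰n)))

choose : ℕ → List A → List (List A)
choose zero    xs       = [] ∷ []
choose (suc k) []       = []
choose (suc k) (x ∷ xs) = map (x ∷_) (choose k xs) ++ choose (suc k) xs

choose-complete : ∀ {xs ys : List A} → ys ⊑ xs → ys ∈ˡ choose (length ys) xs
choose-complete []                        = here refl
choose-complete {ys = []}     (x ∷ʳ ys⊑)  = here refl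
choose-complete {ys = y ∷ ys} (x ∷ʳ ys⊑)  = ∈-++⁺ʳ (map (x ∷_) (choose (length ys) _)) (choose-complete ys⊑)
choose-complete               (refl ∷ ys⊑) = ∈-++⁺ˡ (∈-map⁺ _ (choose-complete ys⊑))

choose-sound : ∀ k (xs : List A) {ys} → ys ∈ˡ choose k xs → ys ⊑ xs × length ys ≡ k
choose-sound zero    xs       (here refl) = Sublist.minimum xs , refl
choose-sound (suc k) (x ∷ xs) ys∈ with ∈-++⁻ (map (x ∷_) (choose k xs)) ys∈
... | inj₂ ys∈′ = let ys⊑ , len = choose-sound (suc k) xs ys∈′ in x ∷ʳ ys⊑ , len
... | inj₁ ys∈′ with ∈-map⁻ (x ∷_) ys∈′
...   | zs , zs∈ , refl = let zs⊑ , len = choose-sound k xs zs∈ in refl ∷ zs⊑ , cong suc len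

Unique-⊑ : ∀ {xs ys : List A} → ys ⊑ xs → Unique xs → Unique ys
Unique-⊑ []           _         = []
Unique-⊑ (x ∷ʳ ys⊑)   (_ ∷ u)   = Unique-⊑ ys⊑ u
Unique-⊑ (refl ∷ ys⊑) (x∉ ∷ u)  = All-resp-⊆ ys⊑ x∉ ∷ Unique-⊑ ys⊑ u

-- The two leading terms of the binomial expansion, just what Pascal's rule asks for in
-- `length-choose-!`.
binomial-≤ : ∀ n k → suc k * n ^ k + n ^ suc k ≤ suc n ^ suc k
binomial-≤ n zero    = ≤-reflexive (eq n)
  where
  eq : ∀ n → 1 + n * 1 ≡ (1 + n) * 1
  eq = solve-∀
binomial-≤ n (suc k) = begin
  suc (suc k) * (n * n ^ k) + n * (n * n ^ k)                    ≤⟨ m≤n+m _ (suc k * n ^ k) ⟩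
  suc k * n ^ k + (suc (suc k) * (n * n ^ k) + n * (n * n ^ k))  ≡⟨ eq n k (n ^ k) ⟩
  suc n * (suc k * n ^ k + n * n ^ k)                            ≤⟨ *-monoʳ-≤ (suc n) (binomial-≤ n k) ⟩
  suc n * (suc n * suc n ^ k)                                    ∎
  where
  open ≤-Reasoning
  eq : ∀ n k p → (1 + k) * p + ((2 + k) * (n * p) + n * (n * p)) ≡ (1 + n) * ((1 + k) * p + n * p)
  eq = solve-∀

length-choose-! : ∀ k (xs : List A) → length (choose k xs) * k ! ≤ length xs ^ k
length-choose-! zero    xs       = ≤-refl
length-choose-! (suc k) []       = z≤n
length-choose-! (suc k) (x ∷ xs) = begin
  length (map (x ∷_) (choose k xs) ++ choose (suc k) xs) * suc k !
    ≡⟨ cong (_* suc k !) (≡.trans (length-++ (map (x ∷_) (choose k xs))) (cong (_+ c₂) (length-map (x ∷_) (choose k xs)))) ⟩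
  (c₁ + c₂) * (suc k * k !)
    ≡⟨ eq c₁ c₂ k (k !) ⟩
  suc k * (c₁ * k !) + c₂ * (suc k * k !)
    ≤⟨ +-mono-≤ (*-monoʳ-≤ (suc k) (length-choose-! k xs)) (length-choose-! (suc k) xs) ⟩
  suc k * length xs ^ k + length xs ^ suc k
    ≤⟨ binomial-≤ (length xs) k ⟩
  suc (length xs) ^ suc k ∎
  where
  open ≤-Reasoning
  c₁ c₂ : ℕ
  c₁ = length (choose k xs)
  c₂ = length (choose (suc k) xs)
  eq : ∀ a b k f → (a + b) * ((1 + k) * f) ≡ (1 + k) * (a * f) + b * ((1 + k) * f)
  eq = solve-∀

length-choose≤ : ∀ k (xs : List A) → length (choose k xs) ≤ length xs ^ k
length-choose≤ k xs = ≤-trans (m≤m*n _ (k !) {{k !≢0}}) (length-choose-! k xs)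

suc^≤ : ∀ k m → suc k ^ m ≤ k ^ m + m * suc k ^ pred m
suc^≤ k zero          = ≤-refl
suc^≤ k (suc zero)    = ≤-reflexive (eq k)
  where
  eq : ∀ k → (1 + k) * 1 ≡ k * 1 + 1
  eq = solve-∀
suc^≤ k (suc (suc m)) = begin
  suc k ^ suc m + k * suc k ^ suc m                          ≤⟨ +-monoʳ-≤ (suc k ^ suc m) (*-monoʳ-≤ k (suc^≤ k (suc m))) ⟩
  suc k ^ suc m + k * (k ^ suc m + suc m * suc k ^ m)        ≤⟨ m≤m+n _ (suc m * suc k ^ m) ⟩
  suc k ^ suc m + k * (k ^ suc m + suc m * suc k ^ m) + suc m * suc k ^ m
                                                             ≡⟨ eq k m (k ^ suc m) (suc k ^ m) ⟩
  k * k ^ suc m + suc (suc m) * (suc k * suc k ^ m)          ∎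
  where
  open ≤-Reasoning
  eq : ∀ k m a b → (1 + k) * b + k * (a + (1 + m) * b) + (1 + m) * b ≡ k * a + (2 + m) * ((1 + k) * b)
  eq = solve-∀

-- By `suc^≤` the increment is at most m (k + 1)^(m - 1), which is at most half of (k + 1)^m.
half-power : ∀ k m → 2 * m ≤ suc k → suc k ^ m ≤ 2 * k ^ m
half-power k zero    _  = s≤s z≤n
half-power k (suc m) 2m≤ = +-cancelʳ-≤ (suc k ^ suc m) _ _ (begin
  suc k ^ suc m + suc k ^ suc m                        ≡⟨ cong (suc k ^ suc m +_) (sym (+-identityʳ _)) ⟩
  2 * suc k ^ suc m                                    ≤⟨ *-monoʳ-≤ 2 (suc^≤ k (suc m)) ⟩
  2 * (k ^ suc m + suc m * suc k ^ m)                  ≡⟨ eq (k ^ suc m) (suc m) (suc k ^ m) ⟩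
  2 * k ^ suc m + 2 * suc m * suc k ^ m                ≤⟨ +-monoʳ-≤ (2 * k ^ suc m) (*-monoˡ-≤ (suc k ^ m) 2m≤) ⟩
  2 * k ^ suc m + suc k ^ suc m                        ∎)
  where
  open ≤-Reasoning
  eq : ∀ a b c → 2 * (a + b * c) ≡ 2 * a + 2 * b * c
  eq = solve-∀

halve : ∀ k → ∃[ m ] (k ≡ m + m ⊎ suc k ≡ m + m)
halve zero    = 0 , inj₁ refl
halve (suc k) with halve k
... | m , inj₁ k≡2m  = suc m , inj₂ (≡.trans (cong (2 +_) k≡2m) (cong suc (sym (+-suc m m))))
... | m , inj₂ sk≡2m = m , inj₁ sk≡2m

-- The true bound on (1 + 1/k)^k is e; 4 comes cheaply, as each half of the exponent contributes a
-- factor of at most 2. For odd k the exponent is first raised to k + 1.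
suc^self≤4 : ∀ k → suc k ^ k ≤ 4 * k ^ k
suc^self≤4 k with halve k
... | m , even-or-odd = helper even-or-odd
  where
  open ≤-Reasoning
  2m≤ : k ≡ m + m ⊎ suc k ≡ m + m → 2 * m ≤ suc k
  2m≤ (inj₁ eq) = ≤-trans (≤-reflexive (≡.trans (cong (m +_) (+-identityʳ m)) (sym eq))) (n≤1+n k)
  2m≤ (inj₂ eq) = ≤-reflexive (≡.trans (cong (m +_) (+-identityʳ m)) (sym eq))
  square : suc k ^ (m + m) ≤ 4 * k ^ (m + m)
  square = begin
    suc k ^ (m + m)           ≡⟨ ^-distribˡ-+-* (suc k) m m ⟩
    suc k ^ m * suc k ^ m     ≤⟨ *-mono-≤ half half ⟩
    2 * k ^ m * (2 * k ^ m)   ≡⟨ eq (k ^ m) ⟩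
    4 * (k ^ m * k ^ m)       ≡⟨ cong (4 *_) (^-distribˡ-+-* k m m) ⟨
    4 * k ^ (m + m)           ∎
    where
    half : suc k ^ m ≤ 2 * k ^ m
    half = half-power k m (2m≤ even-or-odd)
    eq : ∀ a → 2 * a * (2 * a) ≡ 4 * (a * a)
    eq = solve-∀
  helper : k ≡ m + m ⊎ suc k ≡ m + m → suc k ^ k ≤ 4 * k ^ k
  helper (inj₁ k≡2m)  = subst (λ e → suc k ^ e ≤ 4 * k ^ e) (sym k≡2m) square
  helper (inj₂ sk≡2m) = *-cancelˡ-≤ (suc k) (begin
    suc k ^ suc k             ≤⟨ subst (λ e → suc k ^ e ≤ 4 * k ^ e) (sym sk≡2m) square ⟩
    4 * (k * k ^ k)           ≤⟨ *-monoʳ-≤ 4 (*-monoˡ-≤ (k ^ k) (n≤1+n k)) ⟩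
    4 * (suc k * k ^ k)       ≡⟨ eq (suc k) (k ^ k) ⟩
    suc k * (4 * k ^ k)       ∎)
    where
    eq : ∀ a b → 4 * (a * b) ≡ a * (4 * b)
    eq = solve-∀

-- A crude Stirling bound k! ≥ (k/4)^k, obtained by multiplying up `suc^self≤4`.
^self≤4^! : ∀ k → k ^ k ≤ 4 ^ k * k !
^self≤4^! zero    = ≤-refl
^self≤4^! (suc k) = begin
  suc k * suc k ^ k               ≤⟨ *-monoʳ-≤ (suc k) (suc^self≤4 k) ⟩
  suc k * (4 * k ^ k)             ≤⟨ *-monoʳ-≤ (suc k) (*-monoʳ-≤ 4 (^self≤4^! k)) ⟩
  suc k * (4 * (4 ^ k * k !))     ≡⟨ eq (suc k) (4 ^ k) (k !) ⟩
  4 * 4 ^ k * (suc k * k !)       ∎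
  where
  open ≤-Reasoning
  eq : ∀ a b c → a * (4 * (b * c)) ≡ 4 * b * (a * c)
  eq = solve-∀

-- The usual bound (en/k)^k on a binomial coefficient, with 4 in place of e.
length-choose : ∀ k (xs : List A) → length (choose k xs) * k ^ k ≤ (4 * length xs) ^ k
length-choose k xs = begin
  length (choose k xs) * k ^ k             ≤⟨ *-monoʳ-≤ (length (choose k xs)) (^self≤4^! k) ⟩
  length (choose k xs) * (4 ^ k * k !)     ≡⟨ eq (length (choose k xs)) (4 ^ k) (k !) ⟩
  4 ^ k * (length (choose k xs) * k !)     ≤⟨ *-monoʳ-≤ (4 ^ k) (length-choose-! k xs) ⟩
  4 ^ k * length xs ^ k                    ≡⟨ ^-distribʳ-* k 4 (length xs) ⟨
  (4 * length xs) ^ k                      ∎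
  where
  open ≤-Reasoning
  eq : ∀ a b c → a * (b * c) ≡ b * (a * c)
  eq = solve-∀

length-concatMap≤ : ∀ (f : A → List B) xs c → (∀ {x} → x ∈ˡ xs → length (f x) ≤ c) →
                    length (concatMap f xs) ≤ length xs * c
length-concatMap≤ f []       c h = z≤n
length-concatMap≤ f (x ∷ xs) c h = ≤-trans (≤-reflexive (length-++ (f x)))
  (+-mono-≤ (h (here refl)) (length-concatMap≤ f xs c (h ∘ there)))

-- The union bound over blocks of k + k vertices

opaque
  -- Absorbs the constants of the union bound.
  κ : ℕ
  κ = 16 ^ 7

  κ-^ : ∀ Q → 16 ^ (7 * Q) ≡ κ ^ Q
  κ-^ Q = sym (^-*-assoc 16 7 Q)

  16≤κ : 16 ≤ κ
  16≤κ = ^-monoʳ-≤ 16 {1} {7} (s≤s z≤n)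

instance
  κ≢0 : NonZero κ
  κ≢0 = >-nonZero (≤-trans (s≤s z≤n) 16≤κ)

-- The union bound: a is the number of k-subsets of an n-set, b the number of j-subsets of a
-- k²-set, and 1 / q ≈ d / n is the edge density.
module UnionBound
  {n d q k j a b e Q : ℕ} .{{_ : NonZero n}} .{{_ : NonZero d}} .{{_ : NonZero k}} .{{_ : NonZero e}}
  (n≤4dq : n ≤ 4 * d * q)
  (admissible : (κ * k) ^ Q * d ^ (Q + 2 * e) ≤ n ^ Q)
  .{{_ : NonZero Q}} (e≤2Q : e ≤ 2 * Q)
  (many : (2 * e + Q) * k ≤ e * j)
  (a-bound : a * k ^ k ≤ (4 * n) ^ k)
  (b-bound : b * j ^ j ≤ (4 * (k * k)) ^ j)
  where

  open ≤-Reasoning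

  private
    instance
      k^≢0 : ∀ {m} → NonZero (k ^ m)
      k^≢0 {m} = m^n≢0 k m

    k≤j : k ≤ j
    k≤j = *-cancelˡ-≤ e (≤-trans (≤-trans (*-monoˡ-≤ k (≤-trans (m≤m+n e (e + 0)) (m≤m+n (2 * e) Q))) ≤-refl) many)

    b≤ : b ≤ (4 * k) ^ j
    b≤ = *-cancelʳ-≤ b ((4 * k) ^ j) (k ^ j) {{k^≢0 {j}}} (begin
      b * k ^ j             ≤⟨ *-monoʳ-≤ b (^-monoˡ-≤ j k≤j) ⟩
      b * j ^ j             ≤⟨ b-bound ⟩
      (4 * (k * k)) ^ j     ≡⟨ cong (_^ j) (sym (*-assoc 4 k k)) ⟩
      (4 * k * k) ^ j       ≡⟨ ^-distribʳ-* j (4 * k) k ⟩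
      (4 * k) ^ j * k ^ j   ∎)

    density : κ ^ Q * (k ^ Q * d ^ (Q + 2 * e)) ≤ n ^ Q
    density = ≤-trans (≤-reflexive (≡.trans (sym (*-assoc (κ ^ Q) (k ^ Q) _)) (cong (_* d ^ (Q + 2 * e)) (sym (^-distribʳ-* Q κ k))))) admissible

    16kd≤n : 16 * k * d ≤ n
    16kd≤n = ^-cancelʳ-≤ Q _ _ (begin
      (16 * k * d) ^ Q                     ≡⟨ ^-distribʳ-* Q (16 * k) d ⟩
      (16 * k) ^ Q * d ^ Q                 ≤⟨ *-mono-≤ (^-monoˡ-≤ Q (*-monoˡ-≤ k 16≤κ)) (^-monoʳ-≤ d (m≤m+n Q (2 * e))) ⟩
      (κ * k) ^ Q * d ^ (Q + 2 * e)        ≤⟨ admissible ⟩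
      n ^ Q                                ∎)

    -- Origin of the 7 in `κ`: the left side is 16 to the power 3e + Q, and e ≤ 2Q.
    16s : 4 ^ (2 * e) * 16 ^ (2 * e + Q) ≤ κ ^ Q
    16s = begin
      4 ^ (2 * e) * 16 ^ (2 * e + Q)       ≡⟨ cong (_* 16 ^ (2 * e + Q)) (sym (^-*-assoc 4 2 e)) ⟩
      16 ^ e * 16 ^ (2 * e + Q)            ≡⟨ ^-distribˡ-+-* 16 e (2 * e + Q) ⟨
      16 ^ (e + (2 * e + Q))               ≤⟨ ^-monoʳ-≤ 16 exponents ⟩
      16 ^ (7 * Q)                         ≡⟨ κ-^ Q ⟩
      κ ^ Q                                ∎
      where
      exponents : e + (2 * e + Q) ≤ 7 * Q
      exponents = begin
        e + (2 * e + Q)     ≡⟨ e₁ e Q ⟩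
        3 * e + Q           ≤⟨ +-monoˡ-≤ Q (*-monoʳ-≤ 3 e≤2Q) ⟩
        3 * (2 * Q) + Q     ≡⟨ e₂ Q ⟩
        7 * Q               ∎
        where
        e₁ : ∀ e Q → e + (2 * e + Q) ≡ 3 * e + Q
        e₁ = solve-∀
        e₂ : ∀ Q → 3 * (2 * Q) + Q ≡ 7 * Q
        e₂ = solve-∀

    -- Up to constants this is (n/k)^(2e) (kd/n)^(2e+Q) ≤ 1, the k-th root of the e-th power of the
    -- union bound. The powers of n and k collapse to k^Q d^(Q+2e) ≤ n^Q, and so the exponent 1 +
    -- 2e/Q of d arises.
    one-vertex : (4 * n) ^ (2 * e) * (16 * k * d) ^ (2 * e + Q) ≤ n ^ (2 * e + Q) * k ^ (2 * e)
    one-vertex = begin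
      (4 * n) ^ (2 * e) * (16 * k * d) ^ (2 * e + Q)
        ≡⟨ cong₂ _*_ (^-distribʳ-* (2 * e) 4 n) (≡.trans (^-distribʳ-* (2 * e + Q) (16 * k) d)
             (cong₂ _*_ (≡.trans (^-distribʳ-* (2 * e + Q) 16 k) (cong (16 ^ (2 * e + Q) *_) (^-distribˡ-+-* k (2 * e) Q)))
               (cong (d ^_) (+-comm (2 * e) Q)))) ⟩
      4 ^ (2 * e) * n ^ (2 * e) * (16 ^ (2 * e + Q) * (k ^ (2 * e) * k ^ Q) * d ^ (Q + 2 * e))
        ≡⟨ shuffle (4 ^ (2 * e)) (n ^ (2 * e)) (16 ^ (2 * e + Q)) (k ^ (2 * e)) (k ^ Q) (d ^ (Q + 2 * e)) ⟩
      n ^ (2 * e) * k ^ (2 * e) * (4 ^ (2 * e) * 16 ^ (2 * e + Q) * (k ^ Q * d ^ (Q + 2 * e)))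
        ≤⟨ *-monoʳ-≤ (n ^ (2 * e) * k ^ (2 * e)) (≤-trans (*-monoˡ-≤ _ 16s) density) ⟩
      n ^ (2 * e) * k ^ (2 * e) * n ^ Q
        ≡⟨ shuffle′ (n ^ (2 * e)) (k ^ (2 * e)) (n ^ Q) ⟩
      n ^ (2 * e) * n ^ Q * k ^ (2 * e)
        ≡⟨ cong (_* k ^ (2 * e)) (^-distribˡ-+-* n (2 * e) Q) ⟨
      n ^ (2 * e + Q) * k ^ (2 * e) ∎
      where
      shuffle : ∀ a b c d e f → a * b * (c * (d * e) * f) ≡ b * d * (a * c * (e * f))
      shuffle = solve-∀
      shuffle′ : ∀ a b c → a * b * c ≡ a * c * b
      shuffle′ = solve-∀

    J : ℕ
    J = e * j

    -- The k-th power of `one-vertex`. The surplus `r` in the exponent does no harm because 16kd ≤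
    -- n.
    all-vertices : (4 * n) ^ (2 * e * k) * (16 * k * d) ^ J ≤ n ^ J * k ^ (2 * e * k)
    all-vertices with m≤n⇒∃[o]m+o≡n many
    ... | r , eq = begin
      (4 * n) ^ (2 * e * k) * (16 * k * d) ^ J
        ≡⟨ cong (λ J → (4 * n) ^ (2 * e * k) * (16 * k * d) ^ J) (sym eq) ⟩
      (4 * n) ^ (2 * e * k) * (16 * k * d) ^ (w + r)
        ≡⟨ cong₂ _*_ (sym (^-*-assoc (4 * n) (2 * e) k)) (≡.trans (^-distribˡ-+-* (16 * k * d) w r)
             (cong (_* (16 * k * d) ^ r) (sym (^-*-assoc (16 * k * d) (2 * e + Q) k)))) ⟩
      ((4 * n) ^ (2 * e)) ^ k * (((16 * k * d) ^ (2 * e + Q)) ^ k * (16 * k * d) ^ r)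
        ≡⟨ *-assoc (((4 * n) ^ (2 * e)) ^ k) _ _ ⟨
      ((4 * n) ^ (2 * e)) ^ k * ((16 * k * d) ^ (2 * e + Q)) ^ k * (16 * k * d) ^ r
        ≡⟨ cong (_* (16 * k * d) ^ r) (^-distribʳ-* k ((4 * n) ^ (2 * e)) _) ⟨
      ((4 * n) ^ (2 * e) * (16 * k * d) ^ (2 * e + Q)) ^ k * (16 * k * d) ^ r
        ≤⟨ *-mono-≤ (^-monoˡ-≤ k one-vertex) (^-monoˡ-≤ r 16kd≤n) ⟩
      (n ^ (2 * e + Q) * k ^ (2 * e)) ^ k * n ^ r
        ≡⟨ cong (_* n ^ r) (≡.trans (^-distribʳ-* k (n ^ (2 * e + Q)) _)
             (cong₂ _*_ (^-*-assoc n (2 * e + Q) k) (^-*-assoc k (2 * e) k))) ⟩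
      n ^ w * k ^ (2 * e * k) * n ^ r
        ≡⟨ shuffle (n ^ w) (k ^ (2 * e * k)) (n ^ r) ⟩
      n ^ w * n ^ r * k ^ (2 * e * k)
        ≡⟨ cong (_* k ^ (2 * e * k)) (^-distribˡ-+-* n w r) ⟨
      n ^ (w + r) * k ^ (2 * e * k)
        ≡⟨ cong (λ J → n ^ J * k ^ (2 * e * k)) eq ⟩
      n ^ J * k ^ (2 * e * k) ∎
      where
      w : ℕ
      w = (2 * e + Q) * k
      shuffle : ∀ a b c → a * b * c ≡ a * c * b
      shuffle = solve-∀

  -- The e-th power makes the exponent (2 + Q/e) k integral. The extra factor clears the
  -- denominators of a ≤ (4n/k)^k, used twice, and of 1/q ≤ 4d/n.
  union-bound : a * (a * b) ≤ q ^ j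
  union-bound = ^-cancelʳ-≤ e _ _ (*-cancelʳ-≤ _ _ (k ^ (2 * e * k) * (4 * d) ^ J) {{nz}} (begin
    (a * (a * b)) ^ e * (k ^ (2 * e * k) * (4 * d) ^ J)
      ≡⟨ cong (λ z → (a * (a * b)) ^ e * (z * (4 * d) ^ J)) k-power ⟩
    (a * (a * b)) ^ e * ((k ^ k * k ^ k) ^ e * (4 * d) ^ J)
      ≡⟨ regroup ⟩
    (a * k ^ k * (a * k ^ k)) ^ e * (b ^ e * (4 * d) ^ J)
      ≤⟨ *-mono-≤ (^-monoˡ-≤ e (*-mono-≤ a-bound a-bound)) (*-monoˡ-≤ ((4 * d) ^ J) (^-monoˡ-≤ e b≤)) ⟩
    ((4 * n) ^ k * (4 * n) ^ k) ^ e * (((4 * k) ^ j) ^ e * (4 * d) ^ J)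
      ≡⟨ cong₂ _*_ (sym (double (4 * n))) combine ⟩
    (4 * n) ^ (2 * e * k) * (16 * k * d) ^ J
      ≤⟨ all-vertices ⟩
    n ^ J * k ^ (2 * e * k)
      ≤⟨ *-monoˡ-≤ (k ^ (2 * e * k)) (^-monoˡ-≤ J n≤4dq) ⟩
    (4 * d * q) ^ J * k ^ (2 * e * k)
      ≡⟨ cong (_* k ^ (2 * e * k)) (^-distribʳ-* J (4 * d) q) ⟩
    (4 * d) ^ J * q ^ J * k ^ (2 * e * k)
      ≡⟨ shuffle ((4 * d) ^ J) (q ^ J) (k ^ (2 * e * k)) ⟩
    q ^ J * (k ^ (2 * e * k) * (4 * d) ^ J)
      ≡⟨ cong (_* (k ^ (2 * e * k) * (4 * d) ^ J)) (≡.trans (cong (q ^_) (*-comm e j)) (sym (^-*-assoc q j e))) ⟩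
    (q ^ j) ^ e * (k ^ (2 * e * k) * (4 * d) ^ J) ∎))
    where
    shuffle : ∀ a b c → a * b * c ≡ b * (c * a)
    shuffle = solve-∀
    nz : NonZero (k ^ (2 * e * k) * (4 * d) ^ J)
    nz = m*n≢0 _ _ {{k^≢0 {2 * e * k}}} {{m^n≢0 (4 * d) J {{m*n≢0 4 d}}}}
    double : ∀ x → x ^ (2 * e * k) ≡ (x ^ k * x ^ k) ^ e
    double x = ≡.trans (cong (x ^_) (ee e k)) (≡.trans (sym (^-*-assoc x (k + k) e)) (cong (_^ e) (^-distribˡ-+-* x k k)))
      where
      ee : ∀ e k → 2 * e * k ≡ (k + k) * e
      ee = solve-∀
    k-power : k ^ (2 * e * k) ≡ (k ^ k * k ^ k) ^ e
    k-power = double k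
    regroup : (a * (a * b)) ^ e * ((k ^ k * k ^ k) ^ e * (4 * d) ^ J) ≡ (a * k ^ k * (a * k ^ k)) ^ e * (b ^ e * (4 * d) ^ J)
    regroup = ≡.trans (sym (*-assoc ((a * (a * b)) ^ e) _ _)) (≡.trans (cong (_* (4 * d) ^ J)
      (≡.trans (sym (^-distribʳ-* e (a * (a * b)) _)) (≡.trans (cong (_^ e) (sh a b (k ^ k))) (^-distribʳ-* e (a * k ^ k * (a * k ^ k)) b))))
      (*-assoc ((a * k ^ k * (a * k ^ k)) ^ e) (b ^ e) _))
      where
      sh : ∀ a b p → a * (a * b) * (p * p) ≡ a * p * (a * p) * b
      sh = solve-∀
    combine : ((4 * k) ^ j) ^ e * (4 * d) ^ J ≡ (16 * k * d) ^ J
    combine = ≡.trans (cong (_* (4 * d) ^ J) (≡.trans (^-*-assoc (4 * k) j e) (cong ((4 * k) ^_) (*-comm j e))))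
      (≡.trans (sym (^-distribʳ-* J (4 * k) (4 * d))) (cong (_^ J) (sh k d)))
      where
      sh : ∀ k d → 4 * k * (4 * d) ≡ 16 * k * d
      sh = solve-∀

-- Locally sparse bipartite graphs

length-choose-cong : ∀ k {xs : List A} {ys : List B} → length xs ≡ length ys →
                     length (choose k xs) ≡ length (choose k ys)
length-choose-cong zero                      eq = refl
length-choose-cong (suc k) {[]}     {[]}     eq = refl
length-choose-cong (suc k) {x ∷ xs} {y ∷ ys} eq =
  ≡.trans (length-++ (map (x ∷_) (choose k xs)) {choose (suc k) xs}) (≡.trans (cong₂ _+_
    (≡.trans (length-map (x ∷_) (choose k xs)) (≡.trans (length-choose-cong k {xs} {ys} (suc-injective eq)) (sym (length-map (y ∷_) (choose k ys)))))
    (length-choose-cong (suc k) {xs} {ys} (suc-injective eq)))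
  (sym (length-++ (map (y ∷_) (choose k ys)) {choose (suc k) ys})))

length-cartesianProduct : ∀ (xs : List A) (ys : List B) → length (cartesianProduct xs ys) ≡ length xs * length ys
length-cartesianProduct xs ys = ≡.trans (sym (∑-one (cartesianProduct xs ys))) (≡.trans (∑-cartesianProduct xs ys _)
  (≡.trans (∑-cong xs λ _ → ∑-one ys) (∑-const xs _)))

take-⊑ : ∀ k (xs : List A) → take k xs ⊑ xs
take-⊑ zero    xs       = Sublist.minimum xs
take-⊑ (suc k) []       = []
take-⊑ (suc k) (x ∷ xs) = refl ∷ take-⊑ k xs

∑-tabulate : ∀ {n} (g : Fin n → A) (f : A → ℕ) → ∑ (tabulate g) f ≡ sum (f ∘ g)
∑-tabulate {n = zero}  g f = refl
∑-tabulate {n = suc n} g f = cong (f (g zero) +_) (∑-tabulate (g ∘ suc) f)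

∑-allFin : ∀ n (f : Fin n → ℕ) → ∑ (allFin n) f ≡ sum f
∑-allFin n = ∑-tabulate id

length-allFin : ∀ n → length (allFin n) ≡ n
length-allFin n = length-tabulate {n = n} id

∑-concatMap≤ : ∀ (f : A → List B) xs (w : B → ℕ) c → (∀ {x} → x ∈ˡ xs → ∑ (f x) w ≤ c) →
               ∑ (concatMap f xs) w ≤ length xs * c
∑-concatMap≤ f []       w c h = z≤n
∑-concatMap≤ f (x ∷ xs) w c h = ≤-trans (≤-reflexive (∑-++ (f x) _ w))
  (+-mono-≤ (h (here refl)) (∑-concatMap≤ f xs w c (h ∘ there)))

module Restrict (_≟_ : DecidableEquality A) where
  open DecMembership _≟_ using (_∈?_)
  open Counting _≟_

  -- The filter lists the members of `X` in the order of `U`. This mediates between `Sparse`, which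
  -- speaks of lists in any order, and `choose`, which yields sublists only.
  ∑-restrict : ∀ {U X : List A} (f : A → ℕ) → Unique U → Unique X → (∀ {x} → x ∈ˡ X → x ∈ˡ U) →
               ∑ (filterᵇ (λ x → does (x ∈? X)) U) f ≡ ∑ X f
  ∑-restrict {U} {X} f U! X! X⊆U = begin
    ∑ (filterᵇ (λ u → does (u ∈? X)) U) f                       ≡⟨ ∑-filter _ U f ⟩
    ∑ U (λ u → indicator (does (u ∈? X)) * f u)                 ≡⟨ ∑-cong U (λ u → cong (_* f u)
                                                                     (≤-antisym (indicator-∈≤ u X) (indicator-∈≥ u X!))) ⟩
    ∑ U (λ u → ∑ X (λ x → indicator (does (u ≟ x))) * f u)      ≡⟨ ∑-cong U (λ u → ≡.trans (*-comm _ (f u)) (sym (∑-* X (f u) _))) ⟩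
    ∑ U (λ u → ∑ X (λ x → f u * indicator (does (u ≟ x))))      ≡⟨ ∑-swap U X _ ⟩
    ∑ X (λ x → ∑ U (λ u → f u * indicator (does (u ≟ x))))      ≡⟨ ∑-cong X (λ x → ≡.trans (∑-cong U (λ u → same u x)) (∑-* U (f x) _)) ⟩
    ∑ X (λ x → f x * ∑ U (λ u → indicator (does (u ≟ x))))      ≡⟨ ≤-antisym
        (∑-mono X λ x x∈ → ≤-reflexive (≡.trans (cong (f x *_) (∑-δ U! (X⊆U x∈))) (*-identityʳ (f x))))
        (∑-mono X λ x x∈ → ≤-reflexive (sym (≡.trans (cong (f x *_) (∑-δ U! (X⊆U x∈))) (*-identityʳ (f x))))) ⟩
    ∑ X f                                                       ∎
    where
    open ≡.≡-Reasoning
    same : ∀ u x → f u * indicator (does (u ≟ x)) ≡ f x * indicator (does (u ≟ x))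
    same u x with u ≟ x
    ... | yes refl = refl
    ... | no  _    = ≡.trans (*-zeroʳ (f u)) (sym (*-zeroʳ (f x)))

module _ {n : ℕ} where

  _≟ᵉ_ : DecidableEquality (Edge n)
  _≟ᵉ_ = ≡-dec Fin._≟_ Fin._≟_

  open DecMembership _≟ᵉ_ public using () renaming (_∈?_ to _∈ᵉ?_)

  pairs : List (Edge n)
  pairs = cartesianProduct (allFin n) (allFin n)

  pairs-unique : Unique pairs
  pairs-unique = Unique.cartesianProduct⁺ (Unique.allFin⁺ n) (Unique.allFin⁺ n)

  ∈-pairs : ∀ e → e ∈ˡ pairs
  ∈-pairs (a , b) = ∈-cartesianProduct⁺ (∈-allFin a) (∈-allFin b)

  length-pairs : length pairs ≡ n * n
  length-pairs = ≡.trans (length-cartesianProduct (allFin n) (allFin n)) (cong₂ _*_ (length-allFin n) (length-allFin n))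

  ∣∣≡∑ : ∀ (F : EdgeSet n) → ∣ F ∣ ≡ ∑ pairs (indicator ∘ F)
  ∣∣≡∑ F = sym (≡.trans (∑-cartesianProduct (allFin n) (allFin n) _)
    (≡.trans (∑-cong (allFin n) λ a → ∑-allFin n _) (∑-allFin n _)))

  fromList : List (Edge n) → EdgeSet n
  fromList es e = does (e ∈ᵉ? es)

  ∈-fromList⁻ : ∀ {es e} → T (fromList es e) → e ∈ˡ es
  ∈-fromList⁻ {es} {e} t with e ∈ᵉ? es
  ... | yes e∈ = e∈

  ∈-fromList⁺ : ∀ {es e} → e ∈ˡ es → T (fromList es e)
  ∈-fromList⁺ {es} {e} e∈ with e ∈ᵉ? es
  ... | yes _  = _
  ... | no  e∉ = e∉ e∈

  ∑-fromList : ∀ {es} → Unique es → ∑ pairs (indicator ∘ fromList es) ≡ length es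
  ∑-fromList es! = Counting.∑-∈ _≟ᵉ_ pairs-unique es! (λ {e} _ → ∈-pairs e)

  ∣fromList∣ : ∀ {es} → Unique es → ∣ fromList es ∣ ≡ length es
  ∣fromList∣ {es} es! = ≡.trans (∣∣≡∑ (fromList es)) (∑-fromList es!)

  averageDegree : ∀ (G : BipartiteGraph n) {d} → ∣ G ∣ ≡ d * n → HasAverageDegree G d
  averageDegree G {d} eq = ≡.trans (cong₂ _+_ eq (≡.trans (∑-comm {n} {n} (λ b a → indicator (G (a , b)))) eq)) (sym (*-distribˡ-+ d n n))

  -- Sets of t cells inside a k by k block. A set is listed once for every block that contains it,
  -- in keeping with the union bound.
  dense-blocks : ℕ → ℕ → List (List (Edge n))
  dense-blocks k t = concatMap (λ A → concatMap (λ B → choose t (cartesianProduct A B)) (choose k (allFin n))) (choose k (allFin n))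

  dense-blocks-sound : ∀ {k t F} → F ∈ˡ dense-blocks k t → Unique F × length F ≡ t
  dense-blocks-sound {k} {t} F∈ with find (∈-concatMap⁻ _ {xs = choose k (allFin n)} F∈)
  ... | A , A∈ , F∈A with find (∈-concatMap⁻ _ {xs = choose k (allFin n)} F∈A)
  ... | B , B∈ , F∈AB =
    let F⊑ , len = choose-sound t (cartesianProduct A B) F∈AB
        A!       = Unique-⊑ (proj₁ (choose-sound k (allFin n) A∈)) (Unique.allFin⁺ n)
        B!       = Unique-⊑ (proj₁ (choose-sound k (allFin n) B∈)) (Unique.allFin⁺ n)
    in Unique-⊑ F⊑ (Unique.cartesianProduct⁺ A! B!) , len

  dense-blocks-complete : ∀ {k t A B F} → A ⊑ allFin n → length A ≡ k → B ⊑ allFin n → length B ≡ k →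
    F ⊑ cartesianProduct A B → length F ≡ t → F ∈ˡ dense-blocks k t
  dense-blocks-complete {F = F} A⊑ refl B⊑ lenB F⊑ refl =
    ∈-concatMap⁺ _ (lose (choose-complete A⊑) (∈-concatMap⁺ _
      (lose (subst (λ k → _ ∈ˡ choose k (allFin n)) lenB (choose-complete B⊑)) (choose-complete F⊑))))

  length-dense-blocks : ∀ k t → length (dense-blocks k t) ≤
    length (choose k (allFin n)) * (length (choose k (allFin n)) * length (choose t (upTo (k * k))))
  length-dense-blocks k t = length-concatMap≤ _ (choose k (allFin n)) _ λ {A} A∈ →
    length-concatMap≤ _ (choose k (allFin n)) _ λ {B} B∈ → ≤-reflexive (length-choose-cong t
      (≡.trans (length-cartesianProduct A B) (≡.trans (cong₂ _*_ (proj₂ (choose-sound k _ A∈)) (proj₂ (choose-sound k _ B∈)))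
        (sym (length-upTo (k * k))))))

  Sparse : BipartiteGraph n → ℕ → ℕ → Set
  Sparse G k t = ∀ {X Y} → Unique X → Unique Y → length X ≡ k → length Y ≡ k →
    ∑ X (λ a → ∑ Y (λ b → indicator (G (a , b)))) < t

  dense-block-free : ∀ (G : BipartiteGraph n) k t → (∀ {F} → F ∈ˡ dense-blocks k t → ¬ (∀ {e} → e ∈ˡ F → T (G e))) →
                     Sparse G k t
  dense-block-free G k t free {X} {Y} X! Y! lenX lenY = ≰⇒> λ t≤ → free
    (dense-blocks-complete (filter-⊆ (T? ∘ memberOf X) (allFin n)) (len X! lenX) (filter-⊆ (T? ∘ memberOf Y) (allFin n)) (len Y! lenY)
      (Sublist.⊆-trans (take-⊑ t _) (filter-⊆ (T? ∘ G) (cartesianProduct X′ Y′)))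
      (≡.trans (length-take t (filterᵇ G (cartesianProduct X′ Y′))) (m≤n⇒m⊓n≡m (≤-trans t≤ (≤-reflexive count)))))
    λ e∈ → proj₂ (∈-filterᵇ⁻ G {xs = cartesianProduct X′ Y′} (Sublist.lookup (take-⊑ t _) e∈))
    where
    open DecMembership (Fin._≟_ {n}) using (_∈?_)
    open Restrict (Fin._≟_ {n})
    memberOf : List (Fin n) → Fin n → Bool
    memberOf X x = does (x ∈? X)
    X′ Y′ : List (Fin n)
    X′ = filterᵇ (memberOf X) (allFin n)
    Y′ = filterᵇ (memberOf Y) (allFin n)
    restrict : ∀ {X} → Unique X → ∀ f → ∑ (filterᵇ (memberOf X) (allFin n)) f ≡ ∑ X f
    restrict X! f = ∑-restrict f (Unique.allFin⁺ n) X! (λ {x} _ → ∈-allFin x)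
    len : ∀ {X k} → Unique X → length X ≡ k → length (filterᵇ (memberOf X) (allFin n)) ≡ k
    len {X} X! lenX = ≡.trans (sym (∑-one (filterᵇ (memberOf X) (allFin n)))) (≡.trans (restrict X! _) (≡.trans (∑-one X) lenX))
    count : ∑ X (λ a → ∑ Y (λ b → indicator (G (a , b)))) ≡ length (filterᵇ G (cartesianProduct X′ Y′))
    count = sym (≡.trans (length-filterᵇ G (cartesianProduct X′ Y′)) (≡.trans (∑-cartesianProduct X′ Y′ _)
      (≡.trans (∑-cong X′ λ a → restrict Y! _) (restrict X! _))))

  module _ (q : ℕ) .{{_ : NonZero q}} where
    open Greedy {Edge n} q

    weight-count : ∀ vs F → weight vs F * q ^ ∑ vs (indicator ∘ F) ≡ q ^ length vs
    weight-count []       F = refl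
    weight-count (v ∷ vs) F with F v
    ... | true  = ≡.trans (shuffle (weight vs F) q _) (cong (q *_) (weight-count vs F))
      where
      shuffle : ∀ w q p → 1 * w * (q * p) ≡ q * (w * p)
      shuffle = solve-∀
    ... | false = ≡.trans (*-assoc q (weight vs F) _) (cong (q *_) (weight-count vs F))

    -- A set of t pairs is chosen with probability q^(-t), so the expected number of chosen ones is
    -- at most c.
    ∑-weight≤ : ∀ {k t c} → length (dense-blocks k t) ≤ c * q ^ t →
                ∑ (map fromList (dense-blocks k t)) (weight pairs) ≤ c * q ^ length (pairs)
    ∑-weight≤ {k} {t} {c} count = *-cancelʳ-≤ _ _ (q ^ t) {{m^n≢0 q t}} (begin
      ∑ (map fromList Fs) (weight pairs) * q ^ t         ≡⟨ cong (_* q ^ t) (∑-map fromList Fs _) ⟩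
      ∑ Fs (weight pairs ∘ fromList) * q ^ t             ≡⟨ *-comm _ (q ^ t) ⟩
      q ^ t * ∑ Fs (weight pairs ∘ fromList)             ≡⟨ ∑-* Fs (q ^ t) _ ⟨
      ∑ Fs (λ F → q ^ t * weight pairs (fromList F))     ≤⟨ ∑-mono Fs (λ F F∈ → ≤-reflexive (pointwise F∈)) ⟩
      ∑ Fs (λ _ → q ^ length pairs)                      ≡⟨ ∑-const Fs _ ⟩
      length Fs * q ^ length pairs                       ≤⟨ *-monoˡ-≤ (q ^ length pairs) count ⟩
      c * q ^ t * q ^ length pairs                       ≡⟨ shuffle c (q ^ t) (q ^ length pairs) ⟩
      c * q ^ length pairs * q ^ t                       ∎)
      where
      open ≤-Reasoning
      Fs : List (List (Edge n))
      Fs = dense-blocks k t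
      shuffle : ∀ a b c → a * b * c ≡ a * c * b
      shuffle = solve-∀
      pointwise : ∀ {F} → F ∈ˡ Fs → q ^ t * weight pairs (fromList F) ≡ q ^ length pairs
      pointwise {F} F∈ =
        let F! , len = dense-blocks-sound {k} {t} F∈ in
        ≡.trans (*-comm (q ^ t) _) (≡.trans (cong (λ s → weight pairs (fromList F) * q ^ s) (sym (≡.trans (∑-fromList F!) len)))
          (weight-count pairs (fromList F)))

onlyIf : Dec P → List A → List A
onlyIf (yes _) xs = xs
onlyIf (no  _) xs = []

∑-onlyIf≤ : ∀ (P? : Dec P) (xs : List A) f {c} → (P → ∑ xs f ≤ c) → ∑ (onlyIf P? xs) f ≤ c
∑-onlyIf≤ (yes p) xs f h = h p
∑-onlyIf≤ (no  _) xs f h = z≤n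

∈-onlyIf⁻ : ∀ (P? : Dec P) {xs : List A} {x} → x ∈ˡ onlyIf P? xs → x ∈ˡ xs
∈-onlyIf⁻ (yes _) x∈ = x∈

∈-onlyIf⁺ : ∀ (P? : Dec P) {xs : List A} {x} → P → x ∈ˡ xs → x ∈ˡ onlyIf P? xs
∈-onlyIf⁺ (yes _)  p x∈ = x∈
∈-onlyIf⁺ (no  ¬p) p x∈ = contradiction p ¬p

-- The random graph and its forbidden blocks

module SparseGraph (d e Q : ℕ) .{{_ : NonZero d}} .{{_ : NonZero e}} .{{_ : NonZero Q}} (e≤2Q : e ≤ 2 * Q) where

  Admissible : ℕ → ℕ → Set
  Admissible n k = (κ * k) ^ Q * d ^ (Q + 2 * e) ≤ n ^ Q

  -- With e / Q ≈ 2α this is (2 + 1/(2α)) k: fewer edges than that between the two sides of a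
  -- matching of size k leave the contracted graph with average degree at most 2 + 1/α.
  blockEdges : ℕ → ℕ
  blockEdges k = suc ((2 * e + Q) * k ℕ./ e)

  blockEdges-large : ∀ k → (2 * e + Q) * k ≤ e * blockEdges k
  blockEdges-large k = begin
    w                   ≡⟨ m≡m%n+[m/n]*n w e ⟩
    w ℕ.% e + w ℕ./ e * e   ≤⟨ +-monoˡ-≤ _ (<⇒≤ (m%n<n w e)) ⟩
    e + w ℕ./ e * e       ≡⟨ *-comm (suc (w ℕ./ e)) e ⟩
    e * suc (w ℕ./ e)     ∎
    where
    open ≤-Reasoning
    w : ℕ
    w = (2 * e + Q) * k

  Admissible⇒≤ : ∀ {n k} → Admissible n k → k ≤ n
  Admissible⇒≤ {n} {k} adm = ^-cancelʳ-≤ Q k n (begin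
    k ^ Q                               ≤⟨ ^-monoˡ-≤ Q (m≤n*m k κ) ⟩
    (κ * k) ^ Q                    ≤⟨ m≤m*n _ (d ^ (Q + 2 * e)) {{m^n≢0 d (Q + 2 * e)}} ⟩
    (κ * k) ^ Q * d ^ (Q + 2 * e)  ≤⟨ adm ⟩
    n ^ Q                               ∎)
    where open ≤-Reasoning

  -- `smallBlocks` bounds the expected number of blocks that carry a triangle or a pentagon, by
  -- `small-count` with k = 3 and k = 5. The summand 9d makes q at least 3.
  smallBlocks threshold : ℕ
  smallBlocks = (4 * d * 9) ^ 6 + (4 * d * 25) ^ 10
  threshold = suc smallBlocks + 9 * d

  -- With as many edges as vertices, the n^(2k) choices of vertices are cancelled by the edge
  -- probabilities (4d/n)^(2k), leaving a factor free of n.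
  small-count : ∀ {n q} k → n ≤ 4 * d * q →
    length (dense-blocks {n} k (k + k)) ≤ (4 * d * (k * k)) ^ (k + k) * q ^ (k + k)
  small-count {n} {q} k n≤4dq = begin
    length (dense-blocks {n} k (k + k))
      ≤⟨ length-dense-blocks k (k + k) ⟩
    length (choose k (allFin n)) * (length (choose k (allFin n)) * length (choose (k + k) (upTo (k * k))))
      ≤⟨ *-mono-≤ vertices (*-mono-≤ vertices (≤-trans (length-choose≤ (k + k) (upTo (k * k)))
           (≤-reflexive (cong (_^ (k + k)) (length-upTo (k * k)))))) ⟩
    n ^ k * (n ^ k * (k * k) ^ (k + k))
      ≡⟨ ≡.trans (sym (*-assoc (n ^ k) (n ^ k) _)) (cong (_* (k * k) ^ (k + k)) (sym (^-distribˡ-+-* n k k))) ⟩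
    n ^ (k + k) * (k * k) ^ (k + k)
      ≤⟨ *-monoˡ-≤ _ (^-monoˡ-≤ (k + k) n≤4dq) ⟩
    (4 * d * q) ^ (k + k) * (k * k) ^ (k + k)
      ≡⟨ ^-distribʳ-* (k + k) (4 * d * q) (k * k) ⟨
    (4 * d * q * (k * k)) ^ (k + k)
      ≡⟨ cong (_^ (k + k)) (shuffle (4 * d) q (k * k)) ⟩
    (4 * d * (k * k) * q) ^ (k + k)
      ≡⟨ ^-distribʳ-* (k + k) (4 * d * (k * k)) q ⟩
    (4 * d * (k * k)) ^ (k + k) * q ^ (k + k) ∎
    where
    open ≤-Reasoning
    vertices : length (choose k (allFin n)) ≤ n ^ k
    vertices = ≤-trans (length-choose≤ k (allFin n)) (≤-reflexive (cong (_^ k) (length-allFin n)))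
    shuffle : ∀ a b c → a * b * c ≡ a * c * b
    shuffle = solve-∀

  admissible-count : ∀ {n q} k .{{_ : NonZero n}} .{{_ : NonZero k}} → n ≤ 4 * d * q → Admissible n k →
    length (dense-blocks {n} k (blockEdges k)) ≤ 1 * q ^ blockEdges k
  admissible-count {n} {q} k n≤4dq adm = ≤-trans (length-dense-blocks k (blockEdges k)) (≤-trans
    (UnionBound.union-bound {n} {d} {q} {k} {blockEdges k}
      {length (choose k (allFin n))} {length (choose (blockEdges k) (upTo (k * k)))} {e} {Q} n≤4dq adm e≤2Q (blockEdges-large k)
      (≤-trans (length-choose k (allFin n)) (≤-reflexive (cong (λ m → (4 * m) ^ k) (length-allFin n))))
      (≤-trans (length-choose (blockEdges k) (upTo (k * k))) (≤-reflexive (cong (λ m → (4 * m) ^ blockEdges k) (length-upTo (k * k))))))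
    (≤-reflexive (sym (+-identityʳ _))))

  module _ {n : ℕ} (n≥ : n ≥ threshold) where

    private
      instance
        n≢0 : NonZero n
        n≢0 = >-nonZero (≤-trans (s≤s z≤n) n≥)
        3d≢0 : NonZero (3 * d)
        3d≢0 = m*n≢0 3 d

      -- At density 1 / q about 3dn pairs are chosen; the forbidden sets cost at most 2n of them.
      q : ℕ
      q = n ℕ./ (3 * d)

      3dq≤n : 3 * d * q ≤ n
      3dq≤n = ≤-trans (≤-reflexive (*-comm (3 * d) q)) (m/n*n≤m n (3 * d))

      n<3d+3dq : n < 3 * d + 3 * d * q
      n<3d+3dq = begin-strict
        n                            ≡⟨ m≡m%n+[m/n]*n n (3 * d) ⟩
        n ℕ.% (3 * d) + q * (3 * d)    <⟨ +-monoˡ-< _ (m%n<n n (3 * d)) ⟩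
        3 * d + q * (3 * d)          ≡⟨ cong (3 * d +_) (*-comm q (3 * d)) ⟩
        3 * d + 3 * d * q            ∎
        where open ≤-Reasoning

      3≤q : 3 ≤ q
      3≤q = *-cancelˡ-< (3 * d) 2 q (+-cancelˡ-< (3 * d) _ _ (begin-strict
        3 * d + 3 * d * 2            ≡⟨ eq d ⟩
        9 * d                        ≤⟨ m≤n+m (9 * d) (suc smallBlocks) ⟩
        threshold                    ≤⟨ n≥ ⟩
        n                            <⟨ n<3d+3dq ⟩
        3 * d + 3 * d * q            ∎))
        where
        open ≤-Reasoning
        eq : ∀ d → 3 * d + 3 * d * 2 ≡ 9 * d
        eq = solve-∀

      n≤4dq : n ≤ 4 * d * q
      n≤4dq = begin
        n                            ≤⟨ <⇒≤ n<3d+3dq ⟩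
        3 * d + 3 * d * q            ≡⟨ cong (_+ 3 * d * q) (*-comm 3 d) ⟩
        d * 3 + 3 * d * q            ≤⟨ +-monoˡ-≤ _ (*-monoʳ-≤ d 3≤q) ⟩
        d * q + 3 * d * q            ≡⟨ eq d q ⟩
        4 * d * q                    ∎
        where
        open ≤-Reasoning
        eq : ∀ d q → d * q + 3 * d * q ≡ 4 * d * q
        eq = solve-∀

      instance
        q≢0 : NonZero q
        q≢0 = >-nonZero (≤-trans (s≤s z≤n) 3≤q)

      open Greedy {Edge n} q

      admissible? : ∀ k → Dec (Admissible n k)
      admissible? k = (κ * k) ^ Q * d ^ (Q + 2 * e) ≤? n ^ Q

      -- Shifted by one so that block sizes are positive, as the union bound requires. Inadmissible
      -- sizes impose no constraint.
      large-family : ℕ → List (EdgeSet n)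
      large-family k = onlyIf (admissible? (suc k)) (map fromList (dense-blocks {n} (suc k) (blockEdges (suc k))))

      forbidden-large forbidden-small forbidden : List (EdgeSet n)
      forbidden-large = concatMap large-family (upTo n)
      forbidden-small = map fromList (dense-blocks {n} 3 6) ++ map fromList (dense-blocks {n} 5 10)
      forbidden = forbidden-large ++ forbidden-small

      p : ℕ
      p = q ^ length (pairs {n})

      -- One expected violation for each of n sizes is affordable among some 3dn edges, so no decay
      -- in k has to be summed.
      large-weight : ∑ forbidden-large (weight (pairs {n})) ≤ n * p
      large-weight = ≤-trans (∑-concatMap≤ large-family (upTo n) (weight (pairs {n})) p λ {k} _ → one k)
        (≤-reflexive (cong (_* p) (length-upTo n)))
        where
        one : ∀ k → ∑ (large-family k) (weight (pairs {n})) ≤ p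
        one k = ∑-onlyIf≤ (admissible? (suc k)) _ (weight (pairs {n})) λ adm →
          ≤-trans (∑-weight≤ {n} q {suc k} {blockEdges (suc k)} {1} (admissible-count (suc k) n≤4dq adm))
            (≤-reflexive (*-identityˡ p))

      small-weight : ∑ forbidden-small (weight (pairs {n})) ≤ smallBlocks * p
      small-weight = begin
        ∑ forbidden-small (weight (pairs {n}))
          ≡⟨ ∑-++ (map fromList (dense-blocks {n} 3 6)) (map fromList (dense-blocks {n} 5 10)) (weight (pairs {n})) ⟩
        ∑ (map fromList (dense-blocks {n} 3 6)) (weight (pairs {n})) + ∑ (map fromList (dense-blocks {n} 5 10)) (weight (pairs {n}))
          ≤⟨ +-mono-≤ (∑-weight≤ {n} q {3} {6} {(4 * d * 9) ^ 6} (small-count {n} {q} 3 n≤4dq))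
                      (∑-weight≤ {n} q {5} {10} {(4 * d * 25) ^ 10} (small-count {n} {q} 5 n≤4dq)) ⟩
        (4 * d * 9) ^ 6 * p + (4 * d * 25) ^ 10 * p
          ≡⟨ *-distribʳ-+ p ((4 * d * 9) ^ 6) _ ⟨
        smallBlocks * p ∎
        where open ≤-Reasoning

      total-weight : ∑ forbidden (weight (pairs {n})) ≤ p * (n + n)
      total-weight = begin
        ∑ forbidden (weight (pairs {n}))    ≡⟨ ∑-++ forbidden-large forbidden-small _ ⟩
        ∑ forbidden-large (weight (pairs {n})) + ∑ forbidden-small (weight (pairs {n}))
                                      ≤⟨ +-mono-≤ large-weight small-weight ⟩
        n * p + smallBlocks * p       ≤⟨ +-monoʳ-≤ (n * p) (*-monoˡ-≤ p smallBlocks≤n) ⟩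
        n * p + n * p                 ≡⟨ eq n p ⟩
        p * (n + n)                   ∎
        where
        open ≤-Reasoning
        smallBlocks≤n : smallBlocks ≤ n
        smallBlocks≤n = ≤-trans (n≤1+n smallBlocks) (≤-trans (m≤m+n (suc smallBlocks) (9 * d)) n≥)
        eq : ∀ n p → n * p + n * p ≡ p * (n + n)
        eq = solve-∀

      nonempty-block : ∀ {k t F} → F ∈ˡ map fromList (dense-blocks {n} k (suc t)) → Any (T ∘ F) pairs
      nonempty-block {k} {t} F∈ with ∈-map⁻ fromList F∈
      ... | [] , es∈ , refl with () ← proj₂ (dense-blocks-sound {n} {k = k} {suc t} es∈)
      ... | x ∷ es , _ , refl = lose (∈-pairs x) (∈-fromList⁺ {es = x ∷ es} (here refl))

      nonempty : ∀ {F} → F ∈ˡ forbidden → Any (T ∘ F) pairs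
      nonempty F∈ with ∈-++⁻ forbidden-large F∈
      ... | inj₂ F∈small = [ nonempty-block {3} {5} , nonempty-block {5} {9} ]′ (∈-++⁻ (map fromList (dense-blocks {n} 3 6)) F∈small)
      ... | inj₁ F∈large with find (∈-concatMap⁻ large-family {xs = upTo n} F∈large)
      ...   | k , _ , F∈k = nonempty-block {suc k} {(2 * e + Q) * suc k ℕ./ e} (∈-onlyIf⁻ (admissible? (suc k)) F∈k)

      open Independent (greedy pairs forbidden pairs-unique nonempty)

      -- From |S| ≥ n²/q - 2n ≥ 3dn - 2n and n ≤ dn.
      dn≤S : d * n ≤ length S
      dn≤S = +-cancelʳ-≤ (d * n + d * n) _ _ (≤-trans 3dn (+-monoʳ-≤ (length S) (+-mono-≤ (m≤n*m n d) (m≤n*m n d))))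
        where
        open ≤-Reasoning
        nn : n * n ≤ q * length S + q * (n + n)
        nn = *-cancelˡ-≤ p {{m^n≢0 q (length (pairs {n}))}} (begin
          p * (n * n)                                        ≡⟨ cong (p *_) (sym (length-pairs {n})) ⟩
          p * length (pairs {n})                             ≤⟨ large ⟩
          p * q * length S + q * ∑ forbidden (weight (pairs {n}))  ≤⟨ +-monoʳ-≤ (p * q * length S) (*-monoʳ-≤ q total-weight) ⟩
          p * q * length S + q * (p * (n + n))               ≡⟨ eq p q (length S) n ⟩
          p * (q * length S + q * (n + n))                   ∎)
          where
          eq : ∀ p q s n → p * q * s + q * (p * (n + n)) ≡ p * (q * s + q * (n + n))
          eq = solve-∀
        3dn : d * n + (d * n + d * n) ≤ length S + (n + n)
        3dn = *-cancelˡ-≤ q (begin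
          q * (d * n + (d * n + d * n))      ≡⟨ eq q d n ⟩
          3 * d * q * n                      ≤⟨ *-monoˡ-≤ n 3dq≤n ⟩
          n * n                              ≤⟨ nn ⟩
          q * length S + q * (n + n)         ≡⟨ *-distribˡ-+ q (length S) _ ⟨
          q * (length S + (n + n))           ∎)
          where
          eq : ∀ q d n → q * (d * n + (d * n + d * n)) ≡ 3 * d * q * n
          eq = solve-∀

      edges : List (Edge n)
      -- Dropping the surplus makes the average degree exactly d and cannot create a dense block.
      edges = take (d * n) S

      G : BipartiteGraph n
      G = fromList edges

      block-free : ∀ {k t} → (∀ {F} → F ∈ˡ map fromList (dense-blocks {n} k t) → F ∈ˡ forbidden) → Sparse G k t
      block-free {k} {t} blocks⊆ = dense-block-free {n} G k t λ {F} F∈ F⊆G →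
        independent (blocks⊆ (∈-map⁺ fromList F∈)) λ _ v∈F →
          Sublist.lookup (take-⊑ (d * n) S) (∈-fromList⁻ {es = edges} (F⊆G (∈-fromList⁻ {es = F} v∈F)))

      large-⊆ : ∀ k .{{_ : NonZero k}} → Admissible n k →
        ∀ {F} → F ∈ˡ map fromList (dense-blocks {n} k (blockEdges k)) → F ∈ˡ forbidden
      large-⊆ (suc k) adm {F} F∈ = ∈-++⁺ˡ (∈-concatMap⁺ large-family (lose (∈-upTo⁺ (Admissible⇒≤ adm))
        (∈-onlyIf⁺ (admissible? (suc k)) adm F∈)))

    sparse-graph : Σ[ G ∈ BipartiteGraph n ] (HasAverageDegree G d × Sparse G 3 6 × Sparse G 5 10 ×
                     (∀ k .{{_ : NonZero k}} → Admissible n k → Sparse G k (blockEdges k)))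
    sparse-graph = G
      , averageDegree G {d} (≡.trans (∣fromList∣ (Unique-⊑ (take-⊑ (d * n) S) unique))
          (≡.trans (length-take (d * n) S) (m≤n⇒m⊓n≡m dn≤S)))
      , block-free {3} {6} (∈-++⁺ʳ forbidden-large ∘ ∈-++⁺ˡ)
      , block-free {5} {10} (∈-++⁺ʳ forbidden-large ∘ ∈-++⁺ʳ (map fromList (dense-blocks {n} 3 6)))
      , λ k adm → block-free {k} {blockEdges k} (large-⊆ k adm)

-- Contracting a matching

map-unique : ∀ (f : A → B) {xs} → (∀ {x y} → x ∈ˡ xs → y ∈ˡ xs → f x ≡ f y → x ≡ y) →
             Unique xs → Unique (map f xs)
map-unique f inj []        = []
map-unique f {x ∷ xs} inj (x∉ ∷ u) =
  All.tabulate (λ y∈ fx≡y → let z , z∈ , y≡fz = ∈-map⁻ f y∈ in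
    All.lookup x∉ z∈ (inj (here refl) (there z∈) (≡.trans fx≡y y≡fz)))
  ∷ map-unique f (λ p q → inj (there p) (there q)) u

indicator-T : ∀ {b} → T b → 1 ≤ indicator b
indicator-T {true} _ = ≤-refl

module Contraction {n : ℕ} (G : BipartiteGraph n) (M : EdgeSet n) (M⊆G : M ⊆ G) (M-matching : IsMatching M) where

  conflict : Edge n → Edge n → Bool
  conflict e@(a , b) f@(a′ , b′) = not (does (e ≟ᵉ f)) ∧ (G (a , b′) ∨ G (a′ , b))

  private
    distinct : Edge n → Edge n → Bool
    distinct e f = not (does (e ≟ᵉ f))

    distinct-sym : ∀ e f → distinct e f ≡ distinct f e
    distinct-sym e f with e ≟ᵉ f | f ≟ᵉ e
    ... | yes _    | yes _    = refl
    ... | no  _    | no  _    = refl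
    ... | yes e≡f  | no  f≢e  = contradiction (sym e≡f) f≢e
    ... | no  e≢f  | yes f≡e  = contradiction (sym f≡e) e≢f

    conflict-sym : ∀ e f → conflict e f ≡ conflict f e
    conflict-sym e@(a , b) f@(a′ , b′) = cong₂ _∧_ (distinct-sym e f) (∨-comm (G (a , b′)) (G (a′ , b)))

    conflict-irrefl : ∀ e → ¬ T (conflict e e)
    conflict-irrefl e t with e ≟ᵉ e
    ... | no e≢e = e≢e refl

  conflict-complete : ∀ {e f} → e ≢ f → Joined G e f → T (conflict e f)
  conflict-complete {e@(a , b)} {f@(a′ , b′)} e≢f joined with e ≟ᵉ f
  ... | yes e≡f = contradiction e≡f e≢f
  ... | no  _   = or (G (a , b′)) joined
    where
    or : ∀ x {y} → T x ⊎ T y → T (x ∨ y)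
    or true  _        = _
    or false (inj₂ t) = t

  open IndependentSet _≟ᵉ_ conflict conflict-sym conflict-irrefl public

  matched : List (Edge n)
  matched = filterᵇ M pairs

  matched-unique : Unique matched
  matched-unique = Unique.filter⁺ (T? ∘ M) pairs-unique

  ∈-matched⁻ : ∀ {e} → e ∈ˡ matched → T (M e)
  ∈-matched⁻ e∈ = proj₂ (∈-filterᵇ⁻ M {xs = pairs} e∈)

  length-matched : length matched ≡ ∣ M ∣
  length-matched = ≡.trans (length-filterᵇ M pairs) (sym (∣∣≡∑ M))

  -- In the k by k block spanned by the ends, the diagonal holds the k matching edges, and every
  -- conflict puts an edge on one of two mirror cells. So k plus half the degree sum is at most the
  -- number of edges in the block.
  conflict-count : ∀ {k t} → Sparse G k (suc t) → ∀ es → Unique es → (∀ {e} → e ∈ˡ es → e ∈ˡ matched) → length es ≡ k →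
                   degreeSum es + 2 * k ≤ 2 * t
  conflict-count {k} {t} sparse es es! es⊆ len = begin
    degreeSum es + 2 * k
      ≡⟨ cong (degreeSum es +_) diagonal ⟩
    degreeSum es + ∑ es (λ e → ∑ es λ f → 2 * δ e f)
      ≡⟨ ≡.trans (∑-cong es λ e → ∑-+ es _ _) (∑-+ es _ _) ⟨
    ∑ es (λ e → ∑ es λ f → indicator (conflict e f) + 2 * δ e f)
      ≤⟨ ∑-mono es (λ e e∈ → ∑-mono es λ f f∈ → pointwise e f e∈) ⟩
    ∑ es (λ e → ∑ es λ f → cross e f + cross f e)
      ≡⟨ ≡.trans (∑-cong es λ e → ∑-+ es (cross e) _) (∑-+ es (λ e → ∑ es (cross e)) _) ⟩
    ∑ es (λ e → ∑ es (cross e)) + ∑ es (λ e → ∑ es λ f → cross f e)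
      ≡⟨ cong (∑ es (λ e → ∑ es (cross e)) +_) (≡.trans (∑-swap es es _) (sym (+-identityʳ _))) ⟩
    2 * ∑ es (λ e → ∑ es (cross e))
      ≤⟨ *-monoʳ-≤ 2 (s≤s⁻¹ block) ⟩
    2 * t ∎
    where
    open ≤-Reasoning
    δ cross : Edge n → Edge n → ℕ
    δ e f = indicator (does (f ≟ᵉ e))
    cross (a , _) (_ , b′) = indicator (G (a , b′))
    diagonal : 2 * k ≡ ∑ es (λ e → ∑ es λ f → 2 * δ e f)
    diagonal = sym (≡.trans (∑-cong es λ e → ∑-* es 2 (δ e)) (≡.trans (∑-* es 2 _)
      (cong (2 *_) (≡.trans (≤-antisym (∑-mono es λ e e∈ → ≤-reflexive (Counting.∑-δ _≟ᵉ_ es! e∈))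
                                        (∑-mono es λ e e∈ → ≤-reflexive (sym (Counting.∑-δ _≟ᵉ_ es! e∈))))
                     (≡.trans (∑-one es) len)))))
    both : ∀ {x y} → T x → T y → 2 ≤ indicator x + indicator y
    both {true} {true} _ _ = ≤-refl
    either : ∀ x y → indicator (x ∨ y) + 0 ≤ indicator x + indicator y
    either true  y = s≤s z≤n
    either false y = ≤-reflexive (+-identityʳ _)
    pointwise : ∀ e f → e ∈ˡ es → indicator (conflict e f) + 2 * δ e f ≤ cross e f + cross f e
    pointwise e@(a , b) f@(a′ , b′) e∈ with e ≟ᵉ f | f ≟ᵉ e
    ... | yes refl | yes _   = both e∈G e∈G
      where
      e∈G : T (G e)
      e∈G = M⊆G e (∈-matched⁻ (es⊆ e∈))
    ... | yes refl | no  e≢e = contradiction refl e≢e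
    ... | no  e≢e  | yes refl = contradiction refl e≢e
    ... | no  _    | no  _   = either (G (a , b′)) (G (a′ , b))
    ends-unique : ∀ {C : Set} (end : Edge n → C) → (∀ {e f} → T (M e) → T (M f) → end e ≡ end f → e ≡ f) → Unique (map end es)
    ends-unique end inj = map-unique end (λ e∈ f∈ → inj (∈-matched⁻ (es⊆ e∈)) (∈-matched⁻ (es⊆ f∈))) es!
    block : ∑ es (λ e → ∑ es (cross e)) < suc t
    block = subst (_< suc t)
      (≡.trans (∑-map proj₁ es _) (∑-cong es λ e → ∑-map proj₂ es _))
      (sparse (ends-unique proj₁ λ e∈ f∈ eq → M-matching _ _ e∈ f∈ (inj₁ eq))
              (ends-unique proj₂ λ e∈ f∈ eq → M-matching _ _ e∈ f∈ (inj₂ eq))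
              (≡.trans (length-map proj₁ es) len) (≡.trans (length-map proj₂ es) len))

  private
    conflict⇒≢ : ∀ {e f} → T (conflict e f) → e ≢ f
    conflict⇒≢ {e} t refl = conflict-irrefl e t

    two-neighbours : ∀ {es e f g} → Unique es → f ∈ˡ es → g ∈ˡ es → f ≢ g → T (conflict e f) → T (conflict e g) → 2 ≤ deg es e
    two-neighbours {es} {e} {f} {g} es! f∈ g∈ f≢g ef eg = begin
      2                                                      ≡⟨ cong₂ _+_ (∑-δ es! f∈) (∑-δ es! g∈) ⟨
      ∑ es (λ x → δ x f) + ∑ es (λ x → δ x g)                ≡⟨ ∑-+ es (λ x → δ x f) (λ x → δ x g) ⟨
      ∑ es (λ x → δ x f + δ x g)                             ≤⟨ ∑-mono es (λ x _ → pointwise x) ⟩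
      deg es e                                               ∎
      where
      open ≤-Reasoning
      open Counting _≟ᵉ_
      δ : Edge n → Edge n → ℕ
      δ x y = indicator (does (x ≟ᵉ y))
      pointwise : ∀ x → δ x f + δ x g ≤ indicator (conflict e x)
      pointwise x with x ≟ᵉ f | x ≟ᵉ g
      ... | yes refl | yes refl = contradiction refl f≢g
      ... | yes refl | no  _    = indicator-T ef
      ... | no  _    | yes refl = indicator-T eg
      ... | no  _    | no  _    = z≤n

    -- Minimum degree 2 on k + 1 vertices forces k + 1 conflicts; with the k + 1 matching edges they
    -- reach the forbidden 2(k + 1).
    no-cycle : ∀ {k es} → Sparse G (suc k) (suc k + suc k) → Unique es → All (_∈ˡ matched) es → length es ≡ suc k →
               ¬ All (λ e → 2 ≤ deg es e) es
    no-cycle {k} {es} sparse es! es⊆ len min-degree = <-irrefl refl (begin-strict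
      2 * (k + suc k)                ≡⟨ *-distribˡ-+ 2 k (suc k) ⟩
      2 * k + 2 * suc k              <⟨ +-monoˡ-< (2 * suc k) (*-monoʳ-< 2 (n<1+n k)) ⟩
      2 * suc k + 2 * suc k          ≡⟨ cong (_+ 2 * suc k) (≡.trans (*-comm 2 (suc k)) (cong (_* 2) (sym len))) ⟩
      length es * 2 + 2 * suc k      ≡⟨ cong (_+ 2 * suc k) (∑-const es 2) ⟨
      ∑ es (λ _ → 2) + 2 * suc k     ≤⟨ +-monoˡ-≤ (2 * suc k) (∑-mono es λ e → All.lookup min-degree) ⟩
      degreeSum es + 2 * suc k       ≤⟨ conflict-count sparse es es! (All.lookup es⊆) len ⟩
      2 * (k + suc k)                ∎)
      where open ≤-Reasoning

    flip : ∀ {e f} → T (conflict e f) → T (conflict f e)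
    flip {e} {f} = T-sym {e} {f}

  triangleFree : Sparse G 3 6 → TriangleFree matched
  triangleFree sparse {x} {y} {z} x∈ y∈ z∈ xy yz zx =
    no-cycle sparse es! (x∈ ∷ y∈ ∷ z∈ ∷ []) refl
      ( two-neighbours es! (there (here refl)) (there (there (here refl))) (conflict⇒≢ yz) xy (flip {z} zx)
      ∷ two-neighbours es! (here refl) (there (there (here refl))) (conflict⇒≢ zx ∘ sym) (flip {x} xy) yz
      ∷ two-neighbours es! (here refl) (there (here refl)) (conflict⇒≢ xy) zx (flip {y} yz)
      ∷ [])
    where
    es! : Unique (x ∷ y ∷ z ∷ [])
    es! = (conflict⇒≢ xy ∷ (conflict⇒≢ zx ∘ sym) ∷ []) ∷ (conflict⇒≢ yz ∷ []) ∷ [] ∷ []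

  pentagonFree : TriangleFree matched → Sparse G 5 10 → PentagonFree matched
  pentagonFree △-free sparse {v} {w} {x} {y} {z} v∈ w∈ x∈ y∈ z∈ vw wx xy yz zv =
    no-cycle sparse es! (v∈ ∷ w∈ ∷ x∈ ∷ y∈ ∷ z∈ ∷ []) refl
      ( two-neighbours es! #1 #4 w≢z vw (flip {z} zv)
      ∷ two-neighbours es! #0 #2 v≢x (flip {v} vw) wx
      ∷ two-neighbours es! #1 #3 w≢y (flip {w} wx) xy
      ∷ two-neighbours es! #2 #4 x≢z (flip {x} xy) yz
      ∷ two-neighbours es! #3 #0 (v≢y ∘ sym) (flip {y} yz) zv
      ∷ [])
    where
    -- If two non-consecutive vertices of the walk coincide, three of its steps form a triangle.
    v≢x : v ≢ x
    v≢x refl = △-free v∈ y∈ z∈ xy yz zv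
    v≢y : v ≢ y
    v≢y refl = △-free v∈ w∈ x∈ vw wx xy
    w≢y : w ≢ y
    w≢y refl = △-free w∈ z∈ v∈ yz zv vw
    w≢z : w ≢ z
    w≢z refl = △-free w∈ x∈ y∈ wx xy yz
    x≢z : x ≢ z
    x≢z refl = △-free x∈ v∈ w∈ zv vw wx
    es! : Unique (v ∷ w ∷ x ∷ y ∷ z ∷ [])
    es! = (conflict⇒≢ vw ∷ v≢x ∷ v≢y ∷ (conflict⇒≢ zv ∘ sym) ∷ []) ∷ (conflict⇒≢ wx ∷ w≢y ∷ w≢z ∷ [])
        ∷ (conflict⇒≢ xy ∷ x≢z ∷ []) ∷ (conflict⇒≢ yz ∷ []) ∷ [] ∷ []
    #0 : ∀ {e : Edge n} {es} → e ∈ˡ e ∷ es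
    #0 = here refl
    #1 : ∀ {d e : Edge n} {es} → e ∈ˡ d ∷ e ∷ es
    #1 = there #0
    #2 : ∀ {c d e : Edge n} {es} → e ∈ˡ c ∷ d ∷ e ∷ es
    #2 = there #1
    #3 : ∀ {b c d e : Edge n} {es} → e ∈ˡ b ∷ c ∷ d ∷ e ∷ es
    #3 = there #2
    #4 : ∀ {a b c d e : Edge n} {es} → e ∈ˡ a ∷ b ∷ c ∷ d ∷ e ∷ es
    #4 = there #3

-- With i / Q ≈ α the hypotheses on m, s, t say that 1 / α lies well inside (m, m + 2).
module _ {m i s t : ℕ} .{{_ : NonZero i}} (5≤m : 5 ≤ m) (s+t≡2i : s + t ≡ 2 * i) (st-large : 2 * (m * (m + 2) * i) ≤ s * t) where

  private
    Q e : ℕ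
    Q = m * i + s
    e = 2 * i

  -- The average degree E/k is at most 2 + Q/i, and the chord turns this into i m (m+2) ℓ ≥ k (mi +
  -- t). Multiplied by Q = mi + s, the right side becomes k (i² m(m+2) + st). Here st is the gap
  -- between chord and curve; it pays for the 2 in i + 2.
  large-ratio : ∀ k ℓ E b → 2 * (m + 2) * k ≤ m * (m + 2) * ℓ + E → E + 2 * k ≤ 2 * b → b * e ≤ (2 * e + Q) * k →
                k * (i + 2) ≤ Q * ℓ
  large-ratio k ℓ E b large few b≤ = *-cancelˡ-≤ (i * (m * (m + 2))) {{nz}} (begin
    i * (m * (m + 2)) * (k * (i + 2))              ≡⟨ e₁ i m k ⟩
    k * (m * i * (m * i) + m * i * (2 * i) + 2 * (m * (m + 2) * i))
                                                   ≤⟨ *-monoʳ-≤ k (+-monoʳ-≤ (m * i * (m * i) + m * i * (2 * i)) st-large) ⟩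
    k * (m * i * (m * i) + m * i * (2 * i) + s * t) ≡⟨ cong (λ z → k * (m * i * (m * i) + m * i * z + s * t)) s+t≡2i ⟨
    k * (m * i * (m * i) + m * i * (s + t) + s * t) ≡⟨ e₂ i m k s t ⟩
    Q * (k * (m * i + t))                          ≤⟨ *-monoʳ-≤ Q lower ⟩
    Q * (i * (m * (m + 2)) * ℓ)                    ≡⟨ e₃ Q (i * (m * (m + 2))) ℓ ⟩
    i * (m * (m + 2)) * (Q * ℓ)                    ∎)
    where
    open ≤-Reasoning
    nz : NonZero (i * (m * (m + 2)))
    nz = m*n≢0 i _ {{it}} {{m*n≢0 m (m + 2) {{>-nonZero (≤-trans (s≤s z≤n) 5≤m)}} {{>-nonZero (≤-trans (s≤s z≤n) (m≤n+m 2 m))}}}}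
      where
      it : NonZero i
      it = >-nonZero (>-nonZero⁻¹ i)
    e₁ : ∀ i m k → i * (m * (m + 2)) * (k * (i + 2)) ≡ k * (m * i * (m * i) + m * i * (2 * i) + 2 * (m * (m + 2) * i))
    e₁ = solve-∀
    e₂ : ∀ i m k s t → k * (m * i * (m * i) + m * i * (s + t) + s * t) ≡ (m * i + s) * (k * (m * i + t))
    e₂ = solve-∀
    e₃ : ∀ a b c → a * (b * c) ≡ b * (a * c)
    e₃ = solve-∀
    lower : k * (m * i + t) ≤ i * (m * (m + 2)) * ℓ
    lower = *-cancelˡ-≤ 2 (+-cancelʳ-≤ (4 * (i * k) + 2 * (Q * k)) _ _ (begin
      2 * (k * (m * i + t)) + (4 * (i * k) + 2 * ((m * i + s) * k))
        ≡⟨ f₁ k m i s t ⟩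
      4 * (m * i * k) + 4 * (i * k) + 2 * ((s + t) * k)
        ≡⟨ cong (λ z → 4 * (m * i * k) + 4 * (i * k) + 2 * (z * k)) s+t≡2i ⟩
      4 * (m * i * k) + 4 * (i * k) + 2 * (2 * i * k)
        ≡⟨ f₂ k m i ⟩
      2 * i * (2 * (m + 2) * k)
        ≤⟨ *-monoʳ-≤ (2 * i) large ⟩
      2 * i * (m * (m + 2) * ℓ + E)
        ≡⟨ f₃ i m ℓ E ⟩
      2 * (i * (m * (m + 2)) * ℓ) + e * E
        ≤⟨ +-monoʳ-≤ (2 * (i * (m * (m + 2)) * ℓ)) few′ ⟩
      2 * (i * (m * (m + 2)) * ℓ) + (4 * (i * k) + 2 * (Q * k)) ∎))
      where
      f₁ : ∀ k m i s t → 2 * (k * (m * i + t)) + (4 * (i * k) + 2 * ((m * i + s) * k)) ≡ 4 * (m * i * k) + 4 * (i * k) + 2 * ((s + t) * k)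
      f₁ = solve-∀
      f₂ : ∀ k m i → 4 * (m * i * k) + 4 * (i * k) + 2 * (2 * i * k) ≡ 2 * i * (2 * (m + 2) * k)
      f₂ = solve-∀
      f₃ : ∀ i m ℓ E → 2 * i * (m * (m + 2) * ℓ + E) ≡ 2 * (i * (m * (m + 2)) * ℓ) + 2 * i * E
      f₃ = solve-∀
      few′ : e * E ≤ 4 * (i * k) + 2 * (Q * k)
      few′ = +-cancelʳ-≤ (e * (2 * k)) _ _ (begin
        e * E + e * (2 * k)         ≡⟨ *-distribˡ-+ e E _ ⟨
        e * (E + 2 * k)             ≤⟨ *-monoʳ-≤ e few ⟩
        e * (2 * b)                 ≡⟨ g₁ e b ⟩
        2 * (b * e)                 ≤⟨ *-monoʳ-≤ 2 b≤ ⟩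
        2 * ((2 * e + Q) * k)       ≡⟨ g₂ i Q k ⟩
        4 * (i * k) + 2 * (Q * k) + e * (2 * k) ∎)
        where
        g₁ : ∀ e b → e * (2 * b) ≡ 2 * (b * e)
        g₁ = solve-∀
        g₂ : ∀ i Q k → 2 * ((2 * (2 * i) + Q) * k) ≡ 4 * (i * k) + 2 * (Q * k) + 2 * i * (2 * k)
        g₂ = solve-∀

  induced-submatching : ∀ {n k Q′} {G : BipartiteGraph n} .{{_ : NonZero e}} → Q ≡ Q′ →
    Sparse G 3 6 → Sparse G 5 10 → Sparse G k (suc ((2 * e + Q′) * k ℕ./ e)) →
    ∀ M → MatchingIn G M → ∣ M ∣ ≡ k →
    Σ[ M′ ∈ EdgeSet n ] (M′ ⊆ M × MatchingIn G M′ × IsInduced G M′ × k * (i + 2) ≤ Q′ * ∣ M′ ∣)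
  induced-submatching {n} {k} {G = G} refl sparse₃ sparse₅ sparse M (M⊆G , M-matching) ∣M∣≡k =
    M′ , M′⊆M
    , ((λ e e∈ → M⊆G e (M′⊆M e e∈)) , λ e f e∈ f∈ → M-matching e f (M′⊆M e e∈) (M′⊆M f f∈))
    , (λ e f e∈ f∈ e≢f joined → independent (∈-fromList⁻ {es = I} e∈) (∈-fromList⁻ {es = I} f∈) (conflict-complete e≢f joined))
    , subst (λ z → k * (i + 2) ≤ Q * z) (sym (∣fromList∣ unique)) (large-ratio k (length I) (degreeSum matched) ((2 * e + Q) * k ℕ./ e)
        (subst (λ z → 2 * (m + 2) * z ≤ m * (m + 2) * length I + degreeSum matched) len large)
        (conflict-count sparse matched matched-unique id len)
        (m/n*n≤m ((2 * e + Q) * k) e))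
    where
    open Contraction G M M⊆G M-matching
    len : length matched ≡ k
    len = ≡.trans length-matched ∣M∣≡k
    △-free : TriangleFree matched
    △-free = triangleFree sparse₃
    open LargeIndependentSet (independentSet m 5≤m matched matched-unique △-free (pentagonFree △-free sparse₅))
    M′ : EdgeSet n
    M′ = fromList I
    M′⊆M : M′ ⊆ M
    M′⊆M e e∈ = ∈-matched⁻ (subset (∈-fromList⁻ {es = I} e∈))

open import Defs

-- Rational approximation of α

frac : ℕ → (b : ℕ) .{{_ : NonZero b}} → ℚ
frac a b = ℤ.+ a ℚ./ b

frac-≃ : ∀ a b → toℚᵘ (frac a (suc b)) ℚᵘ.≃ mkℚᵘ (ℤ.+ a) b
frac-≃ a b = ℚ.toℚᵘ-fromℚᵘ (mkℚᵘ (ℤ.+ a) b)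

frac-< : ∀ {a b c d} .{{_ : NonZero b}} .{{_ : NonZero d}} → a * d < c * b → frac a b ℚ.< frac c d
frac-< {a} {suc b} {c} {suc d} h = ℚ.toℚᵘ-cancel-<
  (ℚᵘ.<-respˡ-≃ (ℚᵘ.≃-sym (frac-≃ a b)) (ℚᵘ.<-respʳ-≃ (ℚᵘ.≃-sym (frac-≃ c d))
    (*<* (≡.subst₂ ℤ._<_ (ℤ.pos-* a (suc d)) (ℤ.pos-* c (suc b)) (ℤ.+<+ h)))))

frac-<⁻ : ∀ {a b c d} .{{_ : NonZero b}} .{{_ : NonZero d}} → frac a b ℚ.< frac c d → a * d < c * b
frac-<⁻ {a} {suc b} {c} {suc d} h = ℤ.drop‿+<+ (≡.subst₂ ℤ._<_ (sym (ℤ.pos-* a (suc d))) (sym (ℤ.pos-* c (suc b)))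
  (ℚᵘ.drop-*<* (ℚᵘ.<-respˡ-≃ (frac-≃ a b) (ℚᵘ.<-respʳ-≃ (frac-≃ c d) (ℚ.toℚᵘ-mono-< h)))))

frac-≤ : ∀ {a b c d} .{{_ : NonZero b}} .{{_ : NonZero d}} → a * d ≤ c * b → frac a b ℚ.≤ frac c d
frac-≤ {a} {suc b} {c} {suc d} h = ℚ.toℚᵘ-cancel-≤
  (ℚᵘ.≤-respˡ-≃ (ℚᵘ.≃-sym (frac-≃ a b)) (ℚᵘ.≤-respʳ-≃ (ℚᵘ.≃-sym (frac-≃ c d))
    (*≤* (≡.subst₂ ℤ._≤_ (ℤ.pos-* a (suc d)) (ℤ.pos-* c (suc b)) (ℤ.+≤+ h)))))

frac-+ : ∀ a c b .{{_ : NonZero b}} → frac a b ℚ.+ frac c b ≡ frac (a + c) b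
frac-+ a c (suc b) = ℚ.toℚᵘ-injective (ℚᵘ.≃-trans (ℚ.toℚᵘ-homo-+ (frac a (suc b)) (frac c (suc b)))
  (ℚᵘ.≃-trans (ℚᵘ.+-cong (frac-≃ a b) (frac-≃ c b)) (ℚᵘ.≃-trans (*≡* eq) (ℚᵘ.≃-sym (frac-≃ (a + c) b)))))
  where
  den : ℤ
  den = ℤ.+ suc b
  eq : (ℤ.+ a ℤ.* den ℤ.+ ℤ.+ c ℤ.* den) ℤ.* den ≡ ℤ.+ (a + c) ℤ.* ℤ.+ (suc b * suc b)
  eq = ≡.trans (cong (ℤ._* den) (sym (ℤ.*-distribʳ-+ den (ℤ.+ a) (ℤ.+ c))))
    (≡.trans (ℤ.*-assoc (ℤ.+ (a + c)) den den) (cong (ℤ.+ (a + c) ℤ.*_) (sym (ℤ.pos-* (suc b) (suc b)))))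

frac-*₁ : ∀ a c → frac a 1 ℚ.* frac c 1 ≡ frac (a * c) 1
frac-*₁ a c = ℚ.toℚᵘ-injective (ℚᵘ.≃-trans (ℚ.toℚᵘ-homo-* (frac a 1) (frac c 1))
  (ℚᵘ.≃-trans (ℚᵘ.*-cong (frac-≃ a 0) (frac-≃ c 0)) (ℚᵘ.≃-trans (*≡* (cong (ℤ._* ℤ.+ 1) (sym (ℤ.pos-* a c)))) (ℚᵘ.≃-sym (frac-≃ (a * c) 0)))))

frac-^ : ∀ a m → frac a 1 ^ℚ m ≡ frac (a ^ m) 1
frac-^ a zero    = refl
frac-^ a (suc m) = ≡.trans (cong (frac a 1 ℚ.*_) (frac-^ a m)) (frac-*₁ a (a ^ m))

-- Rationals are kept in lowest terms, so numerator and denominator agree with `a` and `b` only up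
-- to proportion.
frac-reduced : ∀ {a b p} .{{_ : NonZero a}} .{{_ : NonZero b}} → p ≡ frac a b →
               ∃[ u ] (↥ p ≡ ℤ.+ u × u * b ≡ a * ↧ₙ p)
frac-reduced {a} {suc b} {p} p≡ with ↥ p in eq | cross
  where
  cross : ↥ p ℤ.* ℤ.+ suc b ≡ ℤ.+ a ℤ.* ↧ p
  cross = ≡.trans (cong (ℤ._* ℤ.+ suc b) (sym (ℚ.↥ᵘ-toℚᵘ p))) (≡.trans (ℚᵘ.drop-*≡* (ℚᵘ.≃-trans (ℚᵘ.≃-reflexive (cong toℚᵘ p≡)) (frac-≃ a b)))
    (cong (λ z → ℤ.+ a ℤ.* ℤ.+ z) (lemma p)))
    where
    lemma : ∀ p → ℚᵘ.↧ₙ (toℚᵘ p) ≡ ↧ₙ p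
    lemma (mkℚ _ _ _) = refl
... | ℤ.+ u      | c = u , refl , ℤ.+-injective (≡.trans (ℤ.pos-* u (suc b)) (≡.trans c (sym (ℤ.pos-* a (↧ₙ p)))))
... | -[1+ u ] | c = contradiction (≡.trans c (sym (ℤ.pos-* a (↧ₙ p)))) λ ()

multiple : ℕ → ℚ → ℚ
multiple zero    p = 0ℚ
multiple (suc m) p = p ℚ.+ multiple m p

multiple-frac : ∀ m a b .{{_ : NonZero b}} → multiple m (frac a b) ≡ frac (m * a) b
multiple-frac zero    a (suc b) = ℚ.toℚᵘ-injective (ℚᵘ.≃-trans (*≡* refl) (ℚᵘ.≃-sym (frac-≃ 0 b)))
multiple-frac (suc m) a b = ≡.trans (cong (frac a b ℚ.+_) (multiple-frac m a b)) (frac-+ a (m * a) b)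

fromℚ-isReal : ∀ r → IsReal (fromℚ r)
fromℚ-isReal r = record
  { L-inhabited = r ℚ.- 1ℚ , ≡.subst (r ℚ.- 1ℚ ℚ.<_) (ℚ.+-identityʳ r) (ℚ.+-monoʳ-< r (ℚ.negative⁻¹ (ℚ.- 1ℚ)))
  ; U-inhabited = r ℚ.+ 1ℚ , ≡.subst (ℚ._< r ℚ.+ 1ℚ) (ℚ.+-identityʳ r) (ℚ.+-monoʳ-< r (ℚ.positive⁻¹ 1ℚ))
  ; L-closed    = ℚ.<-trans
  ; U-closed    = λ p<q r<p → ℚ.<-trans r<p p<q
  ; L-open      = λ p<r → let q , p<q , q<r = ℚ.<-dense p<r in q , p<q , q<r
  ; U-open      = λ r<q → let p , r<p , p<q = ℚ.<-dense r<q in p , p<q , r<p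
  ; disjoint    = ℚ.<-asym
  ; located     = located
  }
  where
  located : ∀ {p q} → p ℚ.< q → p ℚ.< r ⊎ r ℚ.< q
  located {p} {q} p<q with ℚ.<-cmp p r
  ... | tri< p<r _ _ = inj₁ p<r
  ... | tri≈ _ p≡r _ = inj₂ (subst (ℚ._< q) p≡r p<q)
  ... | tri> _ _ r<p = inj₂ (ℚ.<-trans r<p p<q)

L-multiple : ∀ {x r} → (∀ {p} → L x p → p ℚ.< r) → ∀ m {q} → L (m · x) q → q ℚ.< multiple m r
L-multiple bound zero    q<0 = q<0
L-multiple bound (suc m) (p , q , Lp , Lq , refl) = ℚ.+-mono-< (bound Lp) (L-multiple bound m Lq)

-- Lower cuts are open: the empty multiple contains negative numbers only, and `z` is the loss that
-- this causes.
multiple-L : ∀ {x p z} → L x p → z ℚ.< 0ℚ → ∀ m → L (m · x) (multiple m p ℚ.+ z)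
multiple-L {z = z} Lp z<0 zero    = subst (ℚ._< 0ℚ) (sym (ℚ.+-identityˡ z)) z<0
multiple-L {p = p} {z} Lp z<0 (suc m) =
  p , multiple m p ℚ.+ z , Lp , multiple-L Lp z<0 m , ℚ.+-assoc p (multiple m p) z

L<U : ∀ {x p q} → IsReal x → L x p → U x q → p ℚ.< q
L<U {x} {p} {q} x-real Lp Uq with ℚ.<-cmp p q
... | tri< p<q _ _  = p<q
... | tri≈ _ refl _ = contradiction Uq (IsReal.disjoint x-real Lp)
... | tri> _ _ q<p  = contradiction (IsReal.U-closed x-real q<p Uq) (IsReal.disjoint x-real Lp)

·≤ʳ : ∀ {x a b ℓ} .{{_ : NonZero b}} → IsReal x → U x (frac a b) → ∀ k → k * a ≤ b * ℓ → k · x ≤ʳ fromℕ ℓ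
·≤ʳ {a = a} {b} {ℓ} x-real Ua k ka≤bℓ q Lq = ℚ.<-≤-trans (L-multiple (λ Lp → L<U x-real Lp Ua) k Lq)
  (ℚ.≤-trans (ℚ.≤-reflexive (multiple-frac k a b)) (frac-≤ {k * a} {b} {ℓ} {1} (≡.subst₂ _≤_ (sym (*-identityʳ (k * a))) (*-comm b ℓ) ka≤bℓ)))

-- Locatedness of α, applied along the grid of multiples of 1 / Q.
grid : ∀ {α} (Q : ℕ) .{{_ : NonZero Q}} → IsReal α → L α (frac 0 Q) → U α (frac Q Q) →
       ∃[ i ] (L α (frac i Q) × U α (frac (i + 2) Q))
grid {α} Q α-real L₀ U₁ = search Q 0 (+-identityʳ Q) L₀
  where
  search : ∀ fuel i → fuel + i ≡ Q → L α (frac i Q) → ∃[ i ] (L α (frac i Q) × U α (frac (i + 2) Q))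
  search zero       i i≡Q Li = contradiction U₁ (IsReal.disjoint α-real (subst (λ i → L α (frac i Q)) i≡Q Li))
  -- Locatedness only separates two distinct points, here i + 1 and i + 2; hence a gap of two grid
  -- steps.
  search (suc fuel) i eq  Li with IsReal.located α-real (frac-< {i + 1} {Q} {i + 2} {Q} (*-monoˡ-< Q (+-monoʳ-< i (n<1+n 1))))
  ... | inj₁ Li+1 = search fuel (i + 1) (≡.trans (cong (fuel +_) (+-comm i 1)) (≡.trans (+-suc fuel i) eq)) Li+1
  ... | inj₂ Ui+2 = i , Li , Ui+2

record Approximation (α : Cut) : Set where
  field
    i m s t Q    : ℕ
    {{i≢0}}      : NonZero i
    {{Q≢0}}      : NonZero Q
    Q≡mi+s       : m * i + s ≡ Q
    5≤m          : 5 ≤ m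
    s+t≡2i       : s + t ≡ 2 * i
    st-large     : 2 * (m * (m + 2) * i) ≤ s * t
    below        : L α (frac i Q)
    above        : U α (frac (i + 2) Q)

positive-frac : ∀ {q} → 0ℚ ℚ.< q → ∃[ a ] ∃[ b ] q ≡ frac (suc a) (suc b)
positive-frac {q} 0<q with q | ℚ.positive 0<q | ℚ.↥p/↧p≡p q
... | mkℚ (ℤ.+ suc a) b _ | _ | eq = a , b , sym eq

-- Chosen so that half of `slack B` is 8B(B + 1), the value of 2m(m + 2) at m = 2B.
slack : ℕ → ℕ
slack B = 16 * (B * (B + 1))

-- The factor B forces i > 2σ, and the factor r makes σ at most Q/r.
gridSize : ℕ → ℕ → ℕ
gridSize B r = B * r * (2 * slack B + 2)

-- Here 1 / B ≤ α ≤ p / r < 1 / 5, and i / Q is a grid point next to α.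
module Choice (B p r i : ℕ) .{{_ : NonZero B}} .{{_ : NonZero r}}
  (5p<r : p * 5 < r) (Q<B[i+2] : gridSize B r < (i + 2) * B) (ir<pQ : i * r < p * gridSize B r) where

  σ Q : ℕ
  σ = slack B
  Q = gridSize B r

  open ≤-Reasoning

  2σ<i : 2 * σ < i
  2σ<i = +-cancelʳ-< 2 (2 * σ) i (*-cancelʳ-< B _ _ (begin-strict
    (2 * σ + 2) * B          ≤⟨ *-monoˡ-≤ B (m≤n*m (2 * σ + 2) r) ⟩
    r * (2 * σ + 2) * B      ≡⟨ eq r (2 * σ + 2) B ⟩
    Q                        <⟨ Q<B[i+2] ⟩
    (i + 2) * B              ∎))
    where
    eq : ∀ r x b → r * x * b ≡ b * r * x
    eq = solve-∀

  0<i : 0 < i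
  0<i = ≤-<-trans z≤n 2σ<i

  2≤i : 2 ≤ i
  2≤i = ≤-trans (s≤s 1≤σ) (≤-trans (s≤s (m≤n*m σ 2)) 2σ<i)
    where
    1≤σ : 1 ≤ σ
    1≤σ = *-mono-≤ {1} {16} (s≤s z≤n) (*-mono-≤ {1} {B} (>-nonZero⁻¹ B) (m≤n+m 1 B))

  -- For integers 5p < r is worth a whole unit: 5i stays below Q - Q/r, and σ ≤ Q/r.
  5i+σ≤Q : 5 * i + σ ≤ Q
  5i+σ≤Q = <⇒≤ (*-cancelʳ-< r _ _ (begin-strict
    (5 * i + σ) * r          ≡⟨ e₁ i σ r ⟩
    i * r * 5 + r * σ        ≤⟨ +-monoʳ-≤ (i * r * 5) rσ≤Q ⟩
    i * r * 5 + Q            <⟨ +-monoˡ-< Q (*-monoˡ-< 5 ir<pQ) ⟩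
    p * Q * 5 + Q            ≡⟨ e₂ p Q ⟩
    suc (p * 5) * Q          ≤⟨ *-monoˡ-≤ Q 5p<r ⟩
    r * Q                    ≡⟨ *-comm r Q ⟩
    Q * r                    ∎))
    where
    e₁ : ∀ i σ r → (5 * i + σ) * r ≡ i * r * 5 + r * σ
    e₁ = solve-∀
    e₂ : ∀ p Q → p * Q * 5 + Q ≡ (1 + p * 5) * Q
    e₂ = solve-∀
    rσ≤Q : r * σ ≤ Q
    rσ≤Q = *-mono-≤ (m≤n*m r B) (≤-trans (m≤n*m σ 2) (m≤m+n (2 * σ) 2))

  instance
    i≢0 : NonZero i
    i≢0 = >-nonZero 0<i

  m ρ s t : ℕ
  -- Taking σ away before dividing keeps s at least σ, while ρ < i and 2σ < i keep s at most 3i/2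
  -- and so t at least i/2. Thus Q/i is bounded away from both ends of (m, m + 2).
  m = (Q ∸ σ) ℕ./ i
  ρ = (Q ∸ σ) ℕ.% i
  s = σ + ρ
  t = 2 * i ∸ s

  division : Q ∸ σ ≡ ρ + m * i
  division = m≡m%n+[m/n]*n (Q ∸ σ) i

  ρ<i : ρ < i
  ρ<i = m%n<n (Q ∸ σ) i

  Q≡mi+s : m * i + s ≡ Q
  Q≡mi+s = ≡.trans (eq (m * i) σ ρ) (≡.trans (cong (σ +_) (sym division)) (m+[n∸m]≡n (≤-trans (m≤n+m σ (5 * i)) 5i+σ≤Q)))
    where
    eq : ∀ a b c → a + (b + c) ≡ b + (c + a)
    eq = solve-∀

  5≤m : 5 ≤ m
  5≤m = s≤s⁻¹ (*-cancelʳ-< i 5 (suc m) (begin-strict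
    5 * i                    ≡⟨ m+n∸n≡m (5 * i) σ ⟨
    5 * i + σ ∸ σ            ≤⟨ ∸-monoˡ-≤ σ 5i+σ≤Q ⟩
    Q ∸ σ                    ≡⟨ division ⟩
    ρ + m * i                <⟨ +-monoˡ-< (m * i) ρ<i ⟩
    suc m * i                ∎))

  2s≤3i : 2 * s ≤ 3 * i
  2s≤3i = begin
    2 * (σ + ρ)              ≡⟨ *-distribˡ-+ 2 σ ρ ⟩
    2 * σ + 2 * ρ            ≤⟨ +-mono-≤ (<⇒≤ 2σ<i) (*-monoʳ-≤ 2 (<⇒≤ ρ<i)) ⟩
    3 * i                    ∎

  s≤2i : s ≤ 2 * i
  s≤2i = *-cancelˡ-≤ 2 (≤-trans 2s≤3i (≤-trans (*-monoˡ-≤ i (n≤1+n 3)) (≤-reflexive (*-assoc 2 2 i))))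

  s+t≡2i : s + t ≡ 2 * i
  s+t≡2i = m+[n∸m]≡n s≤2i

  i≤2t : i ≤ 2 * t
  i≤2t = +-cancelˡ-≤ (2 * s) _ _ (begin
    2 * s + i                ≤⟨ +-monoˡ-≤ i 2s≤3i ⟩
    3 * i + i                ≡⟨ eq i ⟩
    2 * (2 * i)              ≡⟨ cong (2 *_) s+t≡2i ⟨
    2 * (s + t)              ≡⟨ *-distribˡ-+ 2 s t ⟩
    2 * s + 2 * t            ∎)
    where
    eq : ∀ i → 3 * i + i ≡ 2 * (2 * i)
    eq = solve-∀

  m≤2B : m ≤ 2 * B
  m≤2B = *-cancelʳ-≤ m (2 * B) i (begin
    m * i                    ≤⟨ m≤m+n (m * i) s ⟩
    m * i + s                ≡⟨ Q≡mi+s ⟩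
    Q                        ≤⟨ <⇒≤ Q<B[i+2] ⟩
    (i + 2) * B              ≤⟨ *-monoˡ-≤ B (+-monoʳ-≤ i 2≤i) ⟩
    (i + i) * B              ≡⟨ eq i B ⟩
    2 * B * i                ∎)
    where
    eq : ∀ i b → (i + i) * b ≡ 2 * b * i
    eq = solve-∀

  st-large : 2 * (m * (m + 2) * i) ≤ s * t
  st-large = *-cancelˡ-≤ 2 (begin
    2 * (2 * (m * (m + 2) * i))     ≡⟨ e₁ m i ⟩
    4 * (m * (m + 2)) * i           ≤⟨ *-mono-≤ (*-monoʳ-≤ 4 (*-mono-≤ m≤2B (+-monoˡ-≤ 2 m≤2B))) i≤2t ⟩
    4 * (2 * B * (2 * B + 2)) * (2 * t) ≡⟨ e₂ B t ⟩
    2 * (σ * t)                     ≤⟨ *-monoʳ-≤ 2 (*-monoˡ-≤ t (m≤m+n σ ρ)) ⟩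
    2 * (s * t)                     ∎)
    where
    e₁ : ∀ m i → 2 * (2 * (m * (m + 2) * i)) ≡ 4 * (m * (m + 2)) * i
    e₁ = solve-∀
    e₂ : ∀ B t → 4 * (2 * B * (2 * B + 2)) * (2 * t) ≡ 2 * (16 * (B * (B + 1)) * t)
    e₂ = solve-∀

approximation : ∀ {α} → IsReal α → fromℚ 0ℚ <ʳ α → α <ʳ fromℚ (frac 1 5) → Approximation α
approximation {α} α-real (q₀ , 0<q₀ , Lq₀) (q₁ , Uq₁ , q₁<⅕)
  with positive-frac 0<q₀ | positive-frac (ℚ.<-trans 0<q₀ (L<U α-real Lq₀ Uq₁))
... | a , b , refl | p , r , refl = from-grid (grid Q α-real
    (IsReal.L-closed α-real (frac-< {0} {Q} {suc a} {b₀} (>-nonZero⁻¹ (suc a * Q) {{m*n≢0 (suc a) Q}})) Lq₀)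
    (IsReal.U-closed α-real (frac-< {suc p} {suc r} {Q} {Q} (subst (suc p * Q <_) (*-comm (suc r) Q) (*-monoˡ-< Q p<r))) Uq₁))
  where
  b₀ : ℕ
  b₀ = suc b
  Q : ℕ
  Q = gridSize b₀ (suc r)
  instance
    Q≢0 : NonZero Q
    Q≢0 = m*n≢0 (b₀ * suc r) _ {{m*n≢0 b₀ (suc r)}} {{>-nonZero (≤-trans (s≤s z≤n) (m≤n+m 2 (2 * slack b₀)))}}
  5p<r : suc p * 5 < suc r
  5p<r = subst (suc p * 5 <_) (*-identityˡ (suc r)) (frac-<⁻ {suc p} {suc r} {1} {5} q₁<⅕)
  p<r : suc p < suc r
  p<r = ≤-<-trans (m≤m*n (suc p) 5) 5p<r
  from-grid : ∃[ i ] (L α (frac i Q) × U α (frac (i + 2) Q)) → Approximation α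
  from-grid (i , Li , Ui+2) = record
    { i = i ; m = C.m ; s = C.s ; t = C.t ; Q = Q ; i≢0 = C.i≢0 ; Q≡mi+s = C.Q≡mi+s ; 5≤m = C.5≤m
    ; s+t≡2i = C.s+t≡2i ; st-large = C.st-large ; below = Li ; above = Ui+2 }
    where
    module C = Choice b₀ (suc p) (suc r) i 5p<r
      (≤-<-trans (m≤n*m Q (suc a)) (frac-<⁻ {suc a} {b₀} {i + 2} {Q} (L<U α-real Lq₀ Ui+2)))
      (frac-<⁻ {i} {Q} {suc p} {suc r} (L<U α-real Li Uq₁))

-- Integer roots in place of real powers

integer-root : ∀ b .{{_ : NonZero b}} x → ∃[ y ] (y ^ b ≤ x × x < suc y ^ b)
integer-root (suc b) zero = 0 , z≤n , >-nonZero⁻¹ (1 ^ suc b) {{m^n≢0 1 (suc b)}}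
integer-root b (suc x) with integer-root b x
... | y , y^b≤x , x<y+1^b with suc y ^ b ≤? suc x
...   | yes y+1^b≤x+1 = suc y , y+1^b≤x+1 , ≤-<-trans x<y+1^b (^-monoˡ-< b (n<1+n (suc y)))
...   | no  ≰         = y , m≤n⇒m≤1+n y^b≤x , ≰⇒> ≰

-- The rounded root is at least 1, so y + 1 ≤ 2y: rounding costs at most a factor 2.
integer-root≢0 : ∀ b .{{_ : NonZero b}} x .{{_ : NonZero x}} → ∃[ y ] (NonZero y × y ^ b ≤ x × x ≤ (2 * y) ^ b)
integer-root≢0 b x with integer-root b x
... | zero  , _     , x<1 = contradiction (≤-trans x<1 (≤-reflexive (^-zeroˡ b))) (<⇒≱ (s≤s (>-nonZero⁻¹ x)))
... | suc y , y^b≤x , x<  = suc y , _ , y^b≤x , ≤-trans (<⇒≤ x<) (^-monoˡ-≤ b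
        (≤-trans (s≤s (m≤n+m (suc y) y)) (≤-reflexive (cong (suc y +_) (sym (+-identityʳ (suc y)))))))

power-transfer : ∀ {c k d n y u b w Q} .{{_ : NonZero b}} → d ^ u ≤ (2 * y) ^ b → 2 * (c * k * y) ≤ n → u * Q ≡ w * b →
  (c * k) ^ Q * d ^ w ≤ n ^ Q
power-transfer {c} {k} {d} {n} {y} {u} {b} {w} {Q} d^u≤ 2cky≤n uQ≡wb = ^-cancelʳ-≤ b _ _ (begin
  ((c * k) ^ Q * d ^ w) ^ b         ≡⟨ ^-distribʳ-* b ((c * k) ^ Q) (d ^ w) ⟩
  ((c * k) ^ Q) ^ b * (d ^ w) ^ b   ≡⟨ cong₂ _*_ (^-swap (c * k) Q b) (≡.trans (^-*-assoc d w b)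
                                         (≡.trans (cong (d ^_) (sym uQ≡wb)) (sym (^-*-assoc d u Q)))) ⟩
  ((c * k) ^ b) ^ Q * (d ^ u) ^ Q   ≡⟨ ^-distribʳ-* Q ((c * k) ^ b) (d ^ u) ⟨
  ((c * k) ^ b * d ^ u) ^ Q         ≤⟨ ^-monoˡ-≤ Q (*-monoʳ-≤ ((c * k) ^ b) d^u≤) ⟩
  ((c * k) ^ b * (2 * y) ^ b) ^ Q   ≡⟨ cong (_^ Q) (^-distribʳ-* b (c * k) (2 * y)) ⟨
  ((c * k * (2 * y)) ^ b) ^ Q       ≤⟨ ^-monoˡ-≤ Q (^-monoˡ-≤ b (≤-trans (≤-reflexive (eq (c * k) y)) 2cky≤n)) ⟩
  (n ^ b) ^ Q                       ≡⟨ ^-swap n b Q ⟩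
  (n ^ Q) ^ b                       ∎)
  where
  open ≤-Reasoning
  ^-swap : ∀ x p q → (x ^ p) ^ q ≡ (x ^ q) ^ p
  ^-swap x p q = ≡.trans (^-*-assoc x p q) (≡.trans (cong (x ^_) (*-comm p q)) (sym (^-*-assoc x q p)))
  eq : ∀ a y → a * (2 * y) ≡ 2 * (a * y)
  eq = solve-∀

frac-≡ : ∀ {a b c d} .{{_ : NonZero b}} .{{_ : NonZero d}} → a * d ≡ c * b → frac a b ≡ frac c d
frac-≡ {a} {b} {c} {d} eq = ℚ.≤-antisym (frac-≤ {a} {b} {c} {d} (≤-reflexive eq)) (frac-≤ {c} {d} {a} {b} (≤-reflexive (sym eq)))

module _ {α : Cut} (α-real : IsReal α) {i Q : ℕ} .{{_ : NonZero Q}} (below : L α (frac i Q)) where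

  -- The sum 1 + 4α exceeds 1 + 4i/Q, since L α is open.
  exponent : ∃[ t ] (L (fromℚ 1ℚ +ʳ 4 · α) t × t ≡ frac (Q + 4 * i) Q)
  exponent with IsReal.L-open α-real below
  ... | s , g<s , Ls = t , L-t , t≡
    where
    g t : ℚ
    g = frac i Q
    -- The summands must lie strictly below 1, four times below α, and below the 0 that ends the
    -- multiple. The deficits g - s at 1 and at 0 are made up by using s twice in place of g.
    t = (1ℚ ℚ.+ (g ℚ.- s)) ℚ.+ (s ℚ.+ (s ℚ.+ (g ℚ.+ (g ℚ.+ (g ℚ.- s)))))
    g-s<0 : g ℚ.- s ℚ.< 0ℚ
    g-s<0 = subst (g ℚ.- s ℚ.<_) (ℚ.+-inverseʳ s) (ℚ.+-monoˡ-< (ℚ.- s) g<s)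
    L-t : L (fromℚ 1ℚ +ʳ 4 · α) t
    L-t = _ , _ , subst (1ℚ ℚ.+ (g ℚ.- s) ℚ.<_) (ℚ.+-identityʳ 1ℚ) (ℚ.+-monoʳ-< 1ℚ g-s<0)
        , (_ , _ , Ls , (_ , _ , Ls , (_ , _ , below , (_ , _ , below , g-s<0 , refl) , refl) , refl) , refl) , refl
    t≡ : t ≡ frac (Q + 4 * i) Q
    t≡ = ≡.trans (rearrange g s) (≡.trans (cong₂ ℚ._+_ (frac-≡ {1} {1} {Q} {Q} (*-comm 1 Q)) (multiple-frac 4 i Q)) (frac-+ Q (4 * i) Q))
      where
      open +-*-Solver
      rearrange : ∀ g s → (1ℚ ℚ.+ (g ℚ.- s)) ℚ.+ (s ℚ.+ (s ℚ.+ (g ℚ.+ (g ℚ.+ (g ℚ.- s))))) ≡ 1ℚ ℚ.+ multiple 4 g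
      rearrange = solve 2 (λ g s → (con 1ℚ :+ (g :- s)) :+ (s :+ (s :+ (g :+ (g :+ (g :- s))))) :=
                                   con 1ℚ :+ (g :+ (g :+ (g :+ (g :+ con 0ℚ))))) refl

  power-bound : ∀ {d k n c} .{{_ : NonZero d}} .{{_ : NonZero k}} .{{_ : NonZero c}} .{{_ : NonZero (8 * c)}} →
    k · (d ^ʳ (fromℚ 1ℚ +ʳ 4 · α)) ≤ʳ n · fromℚ (frac 1 (8 * c)) →
    (c * k) ^ Q * d ^ (Q + 4 * i) ≤ n ^ Q
  power-bound {d} {k} {n} {c} k≤ = bound
    where
    t : ℚ
    t = proj₁ exponent
    b : ℕ
    b = ↧ₙ t
    reduced : ∃[ u ] (↥ t ≡ ℤ.+ u × u * Q ≡ (Q + 4 * i) * b)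
    reduced = frac-reduced {Q + 4 * i} {Q} {{>-nonZero (≤-trans (>-nonZero⁻¹ Q) (m≤m+n Q _))}} (proj₂ (proj₂ exponent))
    u : ℕ
    u = proj₁ reduced
    b≢0 : NonZero b
    b≢0 = _
    root : ∃[ y ] (NonZero y × y ^ b ≤ d ^ u × d ^ u ≤ (2 * y) ^ b)
    root = integer-root≢0 b {{b≢0}} (d ^ u) {{m^n≢0 d u}}
    y : ℕ
    y = proj₁ root
    y≢0 : NonZero y
    y≢0 = proj₁ (proj₂ root)
    D : ℕ
    D = 8 * c
    instance
      4D≢0 : NonZero (4 * D)
      4D≢0 = m*n≢0 4 D
    -- The cut wants a rational strictly below the root `y`; half of it costs a factor 2.
    L-y/2 : L (d ^ʳ (fromℚ 1ℚ +ʳ 4 · α)) (frac y 2)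
    L-y/2 = t , frac y 1 , proj₁ (proj₂ exponent)
      , frac-< {y} {2} {y} {1} (*-monoʳ-< y {{y≢0}} (n<1+n 1))
      , frac-≤ {0} {1} {y} {1} z≤n
      , ≡.subst₂ ℚ._≤_ (sym (frac-^ y b)) (cong (d ^ℤ_) (sym (proj₁ (proj₂ reduced))))
          (frac-≤ {y ^ b} {1} {d ^ u} {1} (*-monoˡ-≤ 1 (proj₁ (proj₂ (proj₂ root)))))
    -- The loss forced by `multiple-L`. As ky ≥ 1, it removes at most half of ky/2.
    ¼ : ℚ
    ¼ = frac 1 4
    below-n/D : frac (k * y) 2 ℚ.- ¼ ℚ.< frac (n * 1) D
    below-n/D = ≡.subst₂ ℚ._<_ (cong (ℚ._- ¼) (multiple-frac k y 2)) (multiple-frac n 1 D)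
      (L-multiple id n (k≤ _ (multiple-L L-y/2 (ℚ.negative⁻¹ (ℚ.- ¼)) k)))
    below-sum : frac (k * y) 2 ℚ.< frac (4 * n + D) (4 * D)
    below-sum = ≡.subst₂ ℚ._<_
      (≡.trans (ℚ.+-assoc (frac (k * y) 2) (ℚ.- ¼) ¼) (≡.trans (cong (frac (k * y) 2 ℚ.+_) (ℚ.+-inverseˡ ¼)) (ℚ.+-identityʳ _)))
      (≡.trans (cong₂ ℚ._+_ (frac-≡ {n * 1} {D} {4 * n} {4 * D} (e₁ n D)) (frac-≡ {1} {4} {D} {4 * D} (e₂ D)))
        (frac-+ (4 * n) D (4 * D)))
      (ℚ.+-monoˡ-< ¼ below-n/D)
      where
      e₁ : ∀ n D → n * 1 * (4 * D) ≡ 4 * n * D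
      e₁ = solve-∀
      e₂ : ∀ D → 1 * (4 * D) ≡ D * 4
      e₂ = solve-∀
    2cky≤n : 2 * (c * k * y) ≤ n
    2cky≤n = *-cancelˡ-≤ 8 (+-cancelʳ-≤ (2 * D) _ _ (begin
      8 * (2 * (c * k * y)) + 2 * D               ≤⟨ +-monoʳ-≤ (8 * (2 * (c * k * y))) (*-monoʳ-≤ 2 (m≤n*m D (k * y) {{m*n≢0 k y {{it}} {{y≢0}}}})) ⟩
      8 * (2 * (c * k * y)) + 2 * (k * y * D) ≡⟨ e₁ c k y ⟩
      k * y * (4 * D)                                   ≤⟨ <⇒≤ (frac-<⁻ {k * y} {2} {4 * n + D} {4 * D} below-sum) ⟩
      (4 * n + D) * 2                                   ≡⟨ e₂ n D ⟩
      8 * n + 2 * D                                     ∎))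
      where
      open ≤-Reasoning
      it : NonZero k
      it = >-nonZero (>-nonZero⁻¹ k)
      e₁ : ∀ c k y → 8 * (2 * (c * k * y)) + 2 * (k * y * (8 * c)) ≡ k * y * (4 * (8 * c))
      e₁ = solve-∀
      e₂ : ∀ n D → (4 * n + D) * 2 ≡ 8 * n + 2 * D
      e₂ = solve-∀
    bound : (c * k) ^ Q * d ^ (Q + 4 * i) ≤ n ^ Q
    bound = power-transfer {c} {k} {d} {n} {y} {u} {b} {Q + 4 * i} {Q} {{b≢0}} (proj₂ (proj₂ (proj₂ root))) 2cky≤n (proj₂ (proj₂ reduced))

-- Combining the sparse graph with the independent set bound

open import Data.Integer.Base using (+_)
open import Data.Rational using (_/_)

theorem4p6 : (α : Cut) → IsReal α → fromℚ 0ℚ <ʳ α → α <ʳ fromℚ (+ 1 / 5) →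
    Σ[ c ∈ Cut ] (IsReal c × fromℚ 0ℚ <ʳ c ×
    ((d : ℕ) .{{_ : NonZero d}} →
    ∃[ N ] ((n : ℕ) → n ≥ N →
    Σ[ G ∈ BipartiteGraph n ] (HasAverageDegree G d ×
    ((k : ℕ) .{{_ : NonZero k}} →
    k · (d ^ʳ (fromℚ 1ℚ +ʳ 4 · α)) ≤ʳ n · c →
    Multitasker k α G)))))
theorem4p6 α α-real 0<α α<⅕ =
  fromℚ c , fromℚ-isReal c , ℚ.<-dense 0<c , λ d → SparseGraph.threshold d (2 * i) Q 2i≤2Q , graph d
  where
  open Approximation (approximation α-real 0<α α<⅕)
  instance
    i-nonZero : NonZero i
    i-nonZero = i≢0
    Q-nonZero : NonZero Q
    Q-nonZero = Q≢0
    8κ≢0 : NonZero (8 * κ)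
    8κ≢0 = m*n≢0 8 κ
    2i≢0 : NonZero (2 * i)
    2i≢0 = m*n≢0 2 i
  c : ℚ
  -- Three factors 2 are lost in `power-bound`, to y/2, to ¼ and to rounding the root; `κ` is the
  -- constant of the union bound.
  c = frac 1 (8 * κ)
  0<c : 0ℚ ℚ.< c
  0<c = frac-< {0} {1} {1} {8 * κ} (s≤s z≤n)
  2i≤2Q : 2 * i ≤ 2 * Q
  2i≤2Q = *-monoʳ-≤ 2 (≤-trans (≤-trans (m≤n*m i m {{>-nonZero (≤-trans (s≤s z≤n) 5≤m)}}) (m≤m+n (m * i) s)) (≤-reflexive Q≡mi+s))
  graph : ∀ d .{{_ : NonZero d}} n → n ≥ SparseGraph.threshold d (2 * i) Q 2i≤2Q →
    Σ[ G ∈ BipartiteGraph n ] (HasAverageDegree G d ×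
      (∀ k .{{_ : NonZero k}} → k · (d ^ʳ (fromℚ 1ℚ +ʳ 4 · α)) ≤ʳ n · fromℚ c → Multitasker k α G))
  graph d n n≥ =
    let G , degree , sparse₃ , sparse₅ , sparse = SparseGraph.sparse-graph d (2 * i) Q 2i≤2Q n≥ in
    G , degree , λ k k≤ M M-matching ∣M∣≡k →
      -- The lower grid point serves here: the exponent 1 + 4i/Q lies below 1 + 4α, and 4i is 2e for
      -- e = 2i.
      let admissible = subst (λ z → (κ * k) ^ Q * d ^ (Q + z) ≤ n ^ Q) (*-assoc 2 2 i) (power-bound α-real {i} {Q} below {d} {k} {n} {κ} k≤)
          M′ , M′⊆M , M′-matching , induced , large = induced-submatching 5≤m s+t≡2i st-large Q≡mi+s sparse₃ sparse₅
            (sparse k admissible) M M-matching ∣M∣≡k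
      in M′ , M′⊆M , M′-matching , induced ,
         -- The upper grid point (i + 2)/Q replaces α in the size of the submatching.
         subst (λ z → z · α ≤ʳ fromℕ ∣ M′ ∣) (sym ∣M∣≡k) (·≤ʳ α-real above k large)
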